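{- Let $l$ be a positive integer and let $\mathcal{T}=\{(0\,|\,c^{(t)}) : t\in T\}$ be a set of $l$-multipartition data, each with first entry $0$, where $c^{(t)}=(c^{(t)}_1,\dots,c^{(t)}_l)\in\mathbb{Z}^l$. Let $\mathcal{C}_{\mathcal{T}}=\bigcap_{t\in T}\mathcal{C}_{(0\,|\,c^{(t)})}$ (with $\mathcal{C}_{\mathcal{T}}=\mathcal{P}^l$ if $T=\emptyset$). Then $\mathcal{C}_{\mathcal{T}}$ is finite if and only if $g(\mathcal{T})=1$ and $\mathcal{T}$ satisfies condition X.
   Context: A partition is a weakly decreasing sequence $\lambda=(\lambda_1,\lambda_2,\dots)$ of non-negative integers with finite sum; $\mathcal{P}$ is the set of partitions. For $l\in\mathbb{N}$, an $l$-multipartition is an $l$-tuple $\lambda=(\lambda^{(1)},\dots,\lambda^{(l)})$ of partitions; $\mathcal{P}^l$ is the set of these and $\varnothing^l$ the multipartition with all components empty. The nodes of $\lambda$ are the triples $(a,b,k)\in\mathbb{N}^2\times\{1,\dots,l\}$ with $b\le\lambda^{(k)}_a$. An $l$-multipartition datum is a pair $(s\,|\,c)$ with $s\in\{0,1,2,\dots\}$ and $c\in\mathbb{Z}^l$. The $(s\,|\,c)$-residue of a node $(a,b,k)$ is $b-a+c_k+s\mathbb{Z}\in\mathbb{Z}/s\mathbb{Z}$ (for $s=0$ this is the integer $b-a+c_k$). The $(s\,|\,c)$-content of $\lambda$ is the multiset of $(s\,|\,c)$-residues of its nodes. $\lambda$ is an $(s\,|\,c)$-core if no other $l$-multipartition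 has the same $(s\,|\,c)$-content, except that for $s=1$ the set of $(1\,|\,c)$-cores is defined to be $\{\varnothing^l\}$. $\mathcal{C}_{(s|c)}$ denotes the set of $(s\,|\,c)$-cores. For a set $\mathcal{T}=\{(s^{(t)}\,|\,c^{(t)}):t\in T\}$ of $l$-multipartition data, $g(\mathcal{T})$ is the greatest common divisor of the integers in $\{s^{(t)}:t\in T\}\cup\{c^{(t)}_i-c^{(t)}_j-c^{(u)}_i+c^{(u)}_j : t,u\in T,\ 1\le i,j\le l\}$, with $g(\mathcal{T})=0$ if this set is empty or equals $\{0\}$. An index $k\in\{1,\dots,l\}$ is always maximal if $c^{(t)}_k\ge c^{(t)}_j$ for all $t\in T$ and all $j$; sometimes maximal if there is $t\in T$ with $c^{(t)}_k\ge c^{(t)}_j$ for all $j$; always minimal and sometimes minimal are defined in the same way with the inequalities reversed. $\mathcal{T}$ satisfies condition X if there is at least one $k$ which is sometimes maximal but not always maximal, and at least one $k$ which is sometimes minimal but not always minimal. -}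

module Defs where

open import Data.Nat as ℕ using (ℕ; zero; suc)
open import Data.Integer as ℤ using (ℤ; +_)
open import Data.Integer.Divisibility using () renaming (_∣_ to _∣ℤ_)
open import Data.Fin using (Fin; zero; suc)
open import Data.List using (List; []; _∷_; _++_; map; upTo)
open import Data.List.Relation.Unary.All using (All)
open import Data.List.Relation.Unary.Linked using (Linked)
open import Data.List.Relation.Binary.Permutation.Propositional using (_↭_)
open import Data.List.Membership.Propositional using (_∈_)
open import Data.Vec using (Vec; []; _∷_)
open import Data.Product using (Σ; _×_; Σ-syntax)
open import Data.Sum using (_⊎_)
open import Relation.Binary.PropositionalEquality using (_≡_)
open import Relation.Nullary using (¬_)

-- A partition: a finite list of positive parts, weakly decreasing
-- (λ = (λ₁, λ₂, …) with all trailing zeros omitted; this is a canonical form,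
-- so equality of partitions is equality of lists).
IsPartition : List ℕ → Set
IsPartition p = Linked (λ a b → b ℕ.≤ a) p × All (λ x → 0 ℕ.< x) p

Multipartition : ℕ → Set
Multipartition l = Vec (List ℕ) l

IsMultipartition : ∀ {l} → Multipartition l → Set
IsMultipartition [] = Data.Unit.⊤ where import Data.Unit
IsMultipartition (p ∷ ps) = IsPartition p × IsMultipartition ps

-- (0 | c)-residues of the nodes (a , b , k) of component k, whose rows
-- (starting from row a) are given by the list; residue = b - a + c_k ∈ ℤ.
residuesFrom : ℤ → ℕ → List ℕ → List ℤ
residuesFrom ck a [] = []
residuesFrom ck a (m ∷ ms) =
  map (λ i → (+ suc i ℤ.- + a) ℤ.+ ck) (upTo m) ++ residuesFrom ck (suc a) ms

-- The (0 | c)-content of a multipartition, as a list of residues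
-- (a multiset = list up to permutation).
content0 : ∀ {l} → (Fin l → ℤ) → Multipartition l → List ℤ
content0 c [] = []
content0 c (p ∷ ps) = residuesFrom (c zero) 1 p ++ content0 (λ k → c (suc k)) ps

IsCore0 : ∀ {l} → (Fin l → ℤ) → Multipartition l → Set
IsCore0 c μ = IsMultipartition μ ×
  (∀ ν → IsMultipartition ν → content0 c ν ↭ content0 c μ → ν ≡ μ)

SimCore : ∀ {l} {T : Set} → (T → Fin l → ℤ) → Multipartition l → Set
SimCore {T = T} c μ = IsMultipartition μ × (∀ (t : T) → IsCore0 (c t) μ)

FiniteSet : ∀ {l} → (Multipartition l → Set) → Set
FiniteSet {l} P = Σ[ L ∈ List (Multipartition l) ] (∀ μ → P μ → μ ∈ L)

-- The set of integers whose gcd is g(T), for T = {(0 | c^(t)) : t ∈ T}: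
-- the s^(t) (all 0) and c^(t)_i - c^(t)_j - c^(u)_i + c^(u)_j.
gSet : ∀ {l} {T : Set} → (T → Fin l → ℤ) → ℤ → Set
gSet {l} {T} c x =
  (Σ[ t ∈ T ] x ≡ + 0) ⊎
  (Σ[ t ∈ T ] Σ[ u ∈ T ] Σ[ i ∈ Fin l ] Σ[ j ∈ Fin l ]
     x ≡ ((c t i ℤ.- c t j) ℤ.- c u i) ℤ.+ c u j)

-- g is the (non-negative) greatest common divisor of the set S of integers:
-- g divides every element, and every common divisor divides g.
-- (This gives gcd = 0 for S empty or S = {0}, matching the paper's convention.)
IsGcdOf : (ℤ → Set) → ℕ → Set
IsGcdOf S g = (∀ x → S x → + g ∣ℤ x) ×
              (∀ (d : ℕ) → (∀ x → S x → + d ∣ℤ x) → + d ∣ℤ + g)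

gIsOne : ∀ {l} {T : Set} → (T → Fin l → ℤ) → Set
gIsOne c = IsGcdOf (gSet c) 1

AlwaysMax SometimesMax AlwaysMin SometimesMin :
  ∀ {l} {T : Set} → (T → Fin l → ℤ) → Fin l → Set
AlwaysMax {T = T} c k = ∀ (t : T) j → c t j ℤ.≤ c t k
SometimesMax {T = T} c k = Σ[ t ∈ T ] (∀ j → c t j ℤ.≤ c t k)
AlwaysMin {T = T} c k = ∀ (t : T) j → c t k ℤ.≤ c t j
SometimesMin {T = T} c k = Σ[ t ∈ T ] (∀ j → c t k ℤ.≤ c t j)

ConditionX : ∀ {l} {T : Set} → (T → Fin l → ℤ) → Set
ConditionX {l} c =
  (Σ[ k ∈ Fin l ] (SometimesMax c k × ¬ AlwaysMax c k)) ×
  (Σ[ k ∈ Fin l ] (SometimesMin c k × ¬ AlwaysMin c k))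

-- Component k of a multipartition is encoded by its Maya diagram, the set of beads { λ_a - a + c_k : a ≥ 1 }, and
-- this by its height function x ↦ #{ beads ≥ x }.  Two multipartitions have the same content iff their height
-- functions have the same sum, so μ is a core iff the Maya diagrams form a chain: c_i ≤ c_j implies B_i ⊆ B_j
-- (otherwise two beads can be exchanged; conversely a chain maximises Σ c_k over occupied runners at every position).
--
-- In coordinates independent of t a simultaneous core thus satisfies B_i + c_i - c_j ⊆ B_j for every t with
-- c_i ≤ c_j, and the complement has only c_j - c_i elements.  Going around cycles, every B_k differs from its
-- translate by any element of gSet in boundedly many places, hence, if the gcd is 1, also from its translate by 1.
-- If k is sometimes but not always maximal (or minimal), then B_k is closed under subtracting some S > 0; a gap far
-- below a bead would then force many changes between consecutive positions.  So B_k is bounded, and the index that is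
-- sometimes maximal bounds the beads of all runners, the one that is sometimes minimal their gaps.
--
-- Conversely, without condition X one-row partitions on the always maximal runners, or one-column partitions on the
-- always minimal ones, are simultaneous cores.  If d ≥ 2 divides gSet, choose e with c_i - c_j ≡ e_i - e_j mod d for
-- all t and move all beads of { w : w < e_i } in the residue class 0 by n d places.
module Submission where

open import Defs
open import Level using (0ℓ)
open import Axiom.ExcludedMiddle using (ExcludedMiddle)
open import Data.Empty using (⊥; ⊥-elim)
open import Data.Fin as Fin using (Fin; zero; suc; toℕ)
open import Data.Fin.Properties using (pigeonhole)
open import Data.Integer as ℤ using (ℤ; +_; -[1+_]; 0ℤ; 1ℤ; -1ℤ; ∣_∣; _+_; _*_; _-_; -_; _≤_)
import Data.Integer.DivMod as ℤ
open import Data.Integer.Divisibility.Signed as ℤ using (divides; _∣?_; ∣ᵤ⇒∣; ∣m∣n⇒∣m+n; ∣m+n∣n⇒∣m)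
open import Data.Integer.Properties
open import Data.Integer.Tactic.RingSolver using (solve-∀)
open import Data.List as List using (List; []; _∷_; _++_; length; map; upTo; applyUpTo; cartesianProductWith)
open import Data.List.Membership.Propositional using (_∈_)
open import Data.List.Membership.Propositional.Properties using (∈-∃++; ∈-cartesianProductWith⁺; ∈-upTo⁺)
open import Data.List.Properties using (map-upTo)
open import Data.List.Relation.Binary.Permutation.Propositional as Perm using (_↭_; ↭-sym; ↭-trans; prep; swap)
open import Data.List.Relation.Binary.Permutation.Propositional.Properties using () renaming (shift to ↭-shift)
open import Data.List.Relation.Unary.All as All using (All; []; _∷_)
open import Data.List.Relation.Unary.Any as Any using (here; there)
open import Data.List.Relation.Unary.Any.Properties using (lookup-index)
open import Data.List.Relation.Unary.Linked as Linked using (Linked; []; [-]; _∷_)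
open import Data.Nat as ℕ using (ℕ; zero; suc; _<_)
import Data.Nat.Divisibility as ℕ
import Data.Nat.DivMod as ℕ
open import Data.Nat.Induction using (<-rec)
import Data.Nat.Properties as ℕ
open import Data.Product using (∃; _×_; _,_; proj₁; proj₂)
open import Data.Sum using (_⊎_; inj₁; inj₂; [_,_]′)
open import Data.Unit using (tt)
open import Data.Vec using (Vec; []; _∷_; lookup; tabulate)
open import Data.Vec.Properties using (tabulate∘lookup; tabulate-cong; lookup∘tabulate)
open import Function.Base using (_∘_; _∋_; case_of_)
open import Function.Bundles using (_⇔_; mk⇔)
open import Relation.Binary.Definitions using (tri<; tri≈; tri>)
open import Relation.Binary.PropositionalEquality using (_≡_; _≢_; refl; sym; trans; cong; cong₂; subst)
open import Relation.Nullary using (¬_; yes; no; Dec)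
open import Relation.Nullary.Decidable using (decidable-stable)
open import Algebra.Properties.Semiring.Sum +-*-semiring using (sum; sum-cong-≗; *-distribˡ-sum)

private variable l : ℕ

Δ : (ℤ → ℤ) → ℤ → ℤ
Δ f x = f x - f (1ℤ + x)

-- Linear arithmetic over ℤ

infixl 6 _⊕_ _⊞_

-- An inequality is proved by adding up hypotheses, each turned into a nonnegative difference by nn or from≡, until the
-- sum equals the difference of its two sides (or -1, for a contradiction); similarly for equations with ze and ⊞.
-- solve-∀ only accepts variables, so its identities are stated for variables and then instantiated.
abstract
  nn : ∀ {a b} → a ≤ b → 0ℤ ≤ b - a
  nn = i≤j⇒0≤j-i

  from≡ : ∀ {a b} → a ≡ b → 0ℤ ≤ b - a
  from≡ {a} refl = ≤-reflexive (sym (+-inverseʳ a))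

  _⊕_ : ∀ {a b} → 0ℤ ≤ a → 0ℤ ≤ b → 0ℤ ≤ a + b
  p ⊕ q = +-mono-≤ p q

  le : ∀ {a b e} → 0ℤ ≤ e → b - a ≡ e → a ≤ b
  le p refl = 0≤i-j⇒j≤i p

  absurd : ∀ {A : Set} {e} → 0ℤ ≤ e → e ≡ -1ℤ → A
  absurd () refl

  ze : ∀ {a b} → a ≡ b → 0ℤ ≡ b - a
  ze {a} refl = sym (+-inverseʳ a)

  _⊞_ : ∀ {a b} → 0ℤ ≡ a → 0ℤ ≡ b → 0ℤ ≡ a + b
  p ⊞ q = cong₂ _+_ p q

  eq : ∀ {a b e} → 0ℤ ≡ e → b - a ≡ e → a ≡ b
  eq {a} {b} p q = sym (i-j≡0⇒i≡j b a (trans q (sym p)))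

-- Height functions

≤⇒+ : ∀ {x y} → x ≤ y → ∃ λ n → y ≡ x + + n
≤⇒+ {x} {y} p = ∣ y - x ∣ , trans {j = x + (y - x)} (((∀ u v → u ≡ v + (u - v)) ∋ solve-∀) y x)
    (cong (_+_ x) (sym (0≤i⇒+∣i∣≡i (nn p))))

0≤+ : ∀ {n} → 0ℤ ≤ + n
0≤+ = ℤ.+≤+ ℕ.z≤n

≤-split : ∀ {x y} → x ≤ y → x ≡ y ⊎ 1ℤ + x ≤ y
≤-split {x} {y} p with x ≟ y
... | yes e = inj₁ e
... | no ne = inj₂ (i<j⇒suc[i]≤j (≤∧≢⇒< p ne))

≤-or-> : ∀ x y → x ≤ y ⊎ 1ℤ + y ≤ x
≤-or-> x y with x ≤? y
... | yes p = inj₁ p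
... | no p = inj₂ (i<j⇒suc[i]≤j (≰⇒> p))

-- The Heaviside function with value 1 at 0: `θ (y - z)`, as a function of z, is the height function
-- of a single bead at y.
θ : ℤ → ℤ
θ (+ _)    = 1ℤ
θ -[1+ _ ] = 0ℤ

-- `⁺ (c - x)` is the height function of the set of all integers below c.
⁺ : ℤ → ℤ
⁺ (+ n)    = + n
⁺ -[1+ _ ] = 0ℤ

θ-yes : ∀ {z} → 0ℤ ≤ z → θ z ≡ 1ℤ
θ-yes (ℤ.+≤+ _) = refl

θ-no : ∀ {z} → 1ℤ + z ≤ 0ℤ → θ z ≡ 0ℤ
θ-no {+ n} p = absurd (nn p ⊕ 0≤+ {n}) (((∀ u → 0ℤ - (1ℤ + u) + u ≡ -1ℤ) ∋ solve-∀) (+ n))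
θ-no { -[1+ n ]} p = refl

θ-yes⁻¹ : ∀ {z} → θ z ≡ 1ℤ → 0ℤ ≤ z
θ-yes⁻¹ {+ _} _ = ℤ.+≤+ ℕ.z≤n

⁺-nonneg : ∀ {z} → 0ℤ ≤ z → ⁺ z ≡ z
⁺-nonneg (ℤ.+≤+ _) = refl

⁺-nonpos : ∀ {z} → z ≤ 0ℤ → ⁺ z ≡ 0ℤ
⁺-nonpos { -[1+ n ]} p = refl
⁺-nonpos {+ n} (ℤ.+≤+ ℕ.z≤n) = refl

⁺-suc : ∀ z → ⁺ (1ℤ + z) ≡ ⁺ z + θ z
⁺-suc (+ n) = +-comm 1ℤ (+ n)
⁺-suc -[1+ zero ] = refl
⁺-suc -[1+ suc n ] = refl

Bit : ℤ → Set
Bit a = a ≡ 0ℤ ⊎ a ≡ 1ℤ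

bit≥0 : ∀ {a} → Bit a → 0ℤ ≤ a
bit≥0 (inj₁ refl) = 0≤+
bit≥0 (inj₂ refl) = 0≤+

bit≤1 : ∀ {a} → Bit a → a ≤ 1ℤ
bit≤1 (inj₁ refl) = 0≤+
bit≤1 (inj₂ refl) = ≤-refl

θ-bit : ∀ z → Bit (θ z)
θ-bit (+ _) = inj₂ refl
θ-bit -[1+ _ ] = inj₁ refl

bits-≤ : ∀ {a b} → Bit a → Bit b → (a ≡ 1ℤ → b ≡ 0ℤ → ⊥) → a ≤ b
bits-≤ (inj₁ refl) q h = bit≥0 q
bits-≤ (inj₂ refl) (inj₁ refl) h = ⊥-elim (h refl refl)
bits-≤ (inj₂ refl) (inj₂ refl) h = ≤-refl

θ-mono : ∀ {x y} → x ≤ y → θ x ≤ θ y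
θ-mono {x} {y} p = bits-≤ (θ-bit x) (θ-bit y) λ u v → helper x y p u v where
  helper : ∀ x y → x ≤ y → θ x ≡ 1ℤ → θ y ≡ 0ℤ → ⊥
  helper (+ m) (+ n) p u ()
  helper -[1+ m ] y p () v

-- The Kronecker delta at 0, written through `θ` because a single bead at y contributes `δ (y - z)`
-- to `Δ` at z.
δ : ℤ → ℤ
δ z = θ z - θ (z - 1ℤ)

δ-no : ∀ {z} → ¬ z ≡ 0ℤ → δ z ≡ 0ℤ
δ-no {+ zero} p = ⊥-elim (p refl)
δ-no {+ suc n} p = refl
δ-no { -[1+ n ]} p = refl

δ-bit : ∀ z → Bit (δ z)
δ-bit z with z ≟ 0ℤ
... | yes refl = inj₂ refl
... | no p = inj₁ (δ-no p)

module _ {f : ℤ → ℤ} (anti : ∀ x → f (1ℤ + x) ≤ f x) where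
  antitone+ : ∀ x n → f (x + + n) ≤ f x
  antitone+ x zero = ≤-reflexive (cong f (((∀ u → u + 0ℤ ≡ u) ∋ solve-∀) x))
  antitone+ x (suc n) = ≤-trans (≤-reflexive (cong f (((∀ u v → u + (1ℤ + v) ≡ 1ℤ + (u + v)) ∋ solve-∀) x (+ n))))
      (≤-trans (anti (x + + n)) (antitone+ x n))

  antitone : ∀ {x y} → x ≤ y → f y ≤ f x
  antitone {x} p with ≤⇒+ p
  ... | n , refl = antitone+ x n

EventuallyRight EventuallyLeft : (ℤ → Set) → Set
EventuallyRight P = ∃ λ N → ∀ x → N ≤ x → P x
EventuallyLeft P = ∃ λ N → ∀ x → x ≤ N → P x

right∩ : ∀ {P Q R : ℤ → Set} → (∀ {x} → P x → Q x → R x) → EventuallyRight P → EventuallyRight Q → EventuallyRight R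
right∩ f (M , p) (N , q) = M ℤ.⊔ N , λ x h → f (p x (≤-trans (i≤i⊔j M N) h)) (q x (≤-trans (i≤j⊔i M N) h))

left∩ : ∀ {P Q R : ℤ → Set} → (∀ {x} → P x → Q x → R x) → EventuallyLeft P → EventuallyLeft Q → EventuallyLeft R
left∩ f (M , p) (N , q) = M ℤ.⊓ N , λ x h → f (p x (≤-trans h (i⊓j≤i M N))) (q x (≤-trans h (i⊓j≤j M N)))

module _ {f : ℤ → ℤ} (anti : ∀ x → f (1ℤ + x) ≤ f x) where
  antitone-≥ : ∀ {b} → EventuallyRight (λ x → f x ≡ b) → ∀ x → b ≤ f x
  antitone-≥ (N , r) x = ≤-trans (≤-reflexive (sym (r (N ℤ.⊔ x) (i≤i⊔j N x)))) (antitone anti (i≤j⊔i N x))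

  antitone-≤ : ∀ {a} → EventuallyLeft (λ x → f x ≡ a) → ∀ x → f x ≤ a
  antitone-≤ (N , r) x = ≤-trans (antitone anti (i⊓j≤j N x)) (≤-reflexive (r (N ℤ.⊓ x) (i⊓j≤i N x)))

-- f x is the number of beads ≥ x of a Maya diagram of charge c, so that Δ f is the indicator function of its beads.
record Height (c : ℤ) (f : ℤ → ℤ) : Set where
  field
    bit   : ∀ x → Bit (Δ f x)
    right : EventuallyRight λ x → f x ≡ 0ℤ
    left  : EventuallyLeft λ x → f x ≡ c - x

  Δ≤1 : ∀ x → f x ≤ 1ℤ + f (1ℤ + x)
  Δ≤1 x = le (nn (bit≤1 (bit x))) (((∀ u v → 1ℤ + u - v ≡ 1ℤ - (v - u)) ∋ solve-∀) (f (1ℤ + x)) (f x))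

  -- This quantity counts the gaps below x: it vanishes far to the left and never decreases with x,
  -- since a position holds at most one bead.
  excess : ∀ x → 0ℤ ≤ f x + x - c
  excess x = le (nn (antitone-≤ {λ x → c - x - f x} (λ x → le (nn (Δ≤1 x))
      (((∀ u v w x → u - v - w - (u - (1ℤ + v) - x) ≡ 1ℤ + x - w) ∋ solve-∀) c x (f x) (f (1ℤ + x))))
      (proj₁ left , λ x h → i≡j⇒i-j≡0 (sym (proj₂ left x h))) x))
      (((∀ u v w → u + v - w - 0ℤ ≡ 0ℤ - (w - v - u)) ∋ solve-∀) (f x) x c)

open Height

Δ-shift : ∀ (f : ℤ → ℤ) e x → Δ (λ z → f (z + e)) x ≡ Δ f (x + e)
Δ-shift f e x = cong (λ z → f (x + e) - f z) (((∀ u v → 1ℤ + u + v ≡ 1ℤ + (u + v)) ∋ solve-∀) x e)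

shift : ∀ {c f} e → Height c f → Height (c - e) (λ x → f (x + e))
shift {c} {f} e h .bit x = subst Bit (sym (Δ-shift f e x)) (bit h (x + e))
shift e h .right = proj₁ (right h) - e , λ x p → proj₂ (right h) (x + e)
    (le (nn p) (((∀ u v w → u + v - w ≡ u - (w - v)) ∋ solve-∀) x e (proj₁ (right h))))
shift {c} e h .left = proj₁ (left h) - e , λ x p → trans (proj₂ (left h) (x + e)
    (le (nn p) (((∀ u v w → u - (v + w) ≡ u - w - v) ∋ solve-∀) (proj₁ (left h)) x e)))
    (((∀ u v w → u - (v + w) ≡ u - w - v) ∋ solve-∀) c x e)

-- The difference g - f counts the beads at or above x that g has and f lacks. It is antitone, equal
-- to 0 far to the right and to d - c far to the left.
exchange-bound : ∀ {c d f g} → Height c f → Height d g → (∀ x → Δ f x ≤ Δ g x) → ∀ x →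
  0ℤ ≤ g x - f x × g x - f x ≤ d - c
exchange-bound {c} {d} {f} {g} hf hg le′ x =
  antitone-≥ anti (right∩ (λ p q → cong₂ _-_ p q) (right hg) (right hf)) x ,
  antitone-≤ anti (left∩ (λ {z} p q → trans (cong₂ _-_ p q) (((∀ u v w → u - v - (w - v) ≡ u - w) ∋ solve-∀) d z c))
      (left hg) (left hf)) x
  where
  anti : ∀ x → g (1ℤ + x) - f (1ℤ + x) ≤ g x - f x
  anti x = le (nn (le′ x)) (((∀ u v w x → u - v - (w - x) ≡ u - w - (v - x)) ∋ solve-∀) (g x) (f x) (g (1ℤ + x))
      (f (1ℤ + x)))

-- The diagram whose beads are the negative integers; it belongs to the empty partition in charge 0.
vacuum : ℤ → ℤ
vacuum x = ⁺ (- x)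

Δ-vacuum : ∀ x → Δ vacuum x ≡ θ (- x - 1ℤ)
Δ-vacuum x = trans (cong₂ _-_ (cong ⁺ {x = - x} {1ℤ + (- x - 1ℤ)} (((∀ u → - u ≡ 1ℤ + (- u - 1ℤ)) ∋ solve-∀) x))
    (cong ⁺ { - (1ℤ + x)} { - x - 1ℤ} (((∀ u → - (1ℤ + u) ≡ - u - 1ℤ) ∋ solve-∀) x)))
             (trans (cong (λ z → z - ⁺ (- x - 1ℤ)) (⁺-suc (- x - 1ℤ)))
                 (((∀ u v → u + v - u ≡ v) ∋ solve-∀) (⁺ (- x - 1ℤ)) (θ (- x - 1ℤ))))

vacuum-height : Height 0ℤ vacuum
vacuum-height .bit x = subst Bit (sym (Δ-vacuum x)) (θ-bit _)
vacuum-height .right = 0ℤ , λ x p → ⁺-nonpos (le (nn p) (((∀ u → 0ℤ - - u ≡ u - 0ℤ) ∋ solve-∀) x))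
vacuum-height .left = 0ℤ , λ x p → trans (⁺-nonneg (le (nn p) (((∀ u → - u - 0ℤ ≡ 0ℤ - u) ∋ solve-∀) x)))
    (((∀ u → - u ≡ 0ℤ - u) ∋ solve-∀) x)

-- The height function after the bead at x has been moved to y
move : (x y : ℤ) → (ℤ → ℤ) → ℤ → ℤ
move x y f z = f z + (θ (y - z) - θ (x - z))

Δ-move : ∀ x y f z → Δ (move x y f) z ≡ Δ f z - δ (x - z) + δ (y - z)
Δ-move x y f z = trans {k = Δ f z - (θ (x - z) - θ (x - z - 1ℤ)) + (θ (y - z) - θ (y - z - 1ℤ))}
    (cong₂ (λ u v → f z + (θ (y - z) - θ (x - z)) - (f (1ℤ + z) + (v - u)))
    (cong θ {x - (1ℤ + z)} {x - z - 1ℤ} (((∀ u v → u - (1ℤ + v) ≡ u - v - 1ℤ) ∋ solve-∀) x z))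
    (cong θ {y - (1ℤ + z)} {y - z - 1ℤ} (((∀ u v → u - (1ℤ + v) ≡ u - v - 1ℤ) ∋ solve-∀) y z)))
    (((∀ u v w x y z → u + (v - w) - (x + (y - z)) ≡ u - x - (w - z) + (v - y)) ∋ solve-∀) (f z) (θ (y - z)) (θ (x - z))
    (f (1ℤ + z)) (θ (y - z - 1ℤ)) (θ (x - z - 1ℤ)))

move-ends : ∀ x y → EventuallyRight (λ z → θ (y - z) - θ (x - z) ≡ 0ℤ) × EventuallyLeft (λ z →
  θ (y - z) - θ (x - z) ≡ 0ℤ)
move-ends x y =
  right∩ (λ p q → cong₂ _-_ p q) (far y) (far x) ,
  left∩ (λ p q → cong₂ _-_ p q) (near y) (near x)
  where
  far : ∀ y → EventuallyRight λ z → θ (y - z) ≡ 0ℤ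
  far y = 1ℤ + y , λ z p → θ-no (le (nn p) (((∀ u v → 0ℤ - (1ℤ + (u + - v)) ≡ v - (1ℤ + u)) ∋ solve-∀) y z))
  near : ∀ y → EventuallyLeft λ z → θ (y - z) ≡ 1ℤ
  near y = y , λ z p → θ-yes (nn p)

move-height : ∀ {c f x y} → Height c f → Δ f x ≡ 1ℤ → Δ f y ≡ 0ℤ → Height c (move x y f)
move-height {c} {f} {x} {y} h fx fy = record
  { bit = λ z → subst Bit (sym (Δ-move x y f z)) (go z)
  ; right = right∩ (cong₂ _+_) (right h) (proj₁ (move-ends x y))
  ; left = left∩ (λ {z} p q → (trans (cong₂ _+_ p q) (+-identityʳ _))) (left h) (proj₂ (move-ends x y))
  }
  where
  go : ∀ z → Bit (Δ f z - δ (x - z) + δ (y - z))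
  go z with x - z ≟ 0ℤ | y - z ≟ 0ℤ
  ... | no p | no q = subst Bit (trans (((∀ u v → u - v ≡ u - v - 0ℤ + 0ℤ) ∋ solve-∀) (f z) (f (1ℤ + z)))
      (sym (cong₂ (λ u v → Δ f z - u + v) (δ-no p) (δ-no q)))) (bit h z)
  ... | yes p | no q = inj₁ (trans (cong₂ (λ u v → Δ f z - u + v) (cong δ p) (δ-no q))
      (cong (λ t → t - 1ℤ + 0ℤ) (trans (cong (Δ f) (sym (i-j≡0⇒i≡j x z p))) fx)))
  ... | no p | yes q = inj₂ (trans (cong₂ (λ u v → Δ f z - u + v) (δ-no p) (cong δ q))
      (cong (λ t → t - 0ℤ + 1ℤ) (trans (cong (Δ f) (sym (i-j≡0⇒i≡j y z q))) fy)))
  ... | yes p | yes q with trans (sym fx) (trans (cong (Δ f) (trans (i-j≡0⇒i≡j x z p) (sym (i-j≡0⇒i≡j y z q)))) fy)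
  ... | ()

-- Partitions

Decreasing : List ℕ → Set
Decreasing = Linked λ a b → b ℕ.≤ a

-- The first row gives the bead c - 1 + m. Lowering the charge for the tail accounts for the row
-- index, and the infinitely many empty rows fill all integers below the charge that is left.
height : ℤ → List ℕ → ℤ → ℤ
height c []       x = ⁺ (c - x)
height c (m ∷ ms) x = θ (c - 1ℤ + + m - x) + height (c - 1ℤ) ms x

height-cong : ∀ {c d f g} → c ≡ d → (∀ x → f x ≡ g x) → Height c f → Height d g
height-cong refl e h .bit x = subst Bit (cong₂ _-_ (e x) (e (1ℤ + x))) (bit h x)
height-cong refl e h .right = proj₁ (right h) , λ x p → trans (sym (e x)) (proj₂ (right h) x p)
height-cong refl e h .left = proj₁ (left h) , λ x p → trans (sym (e x)) (proj₂ (left h) x p)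

-- The list `m ∷ p` only serves to bound p: its parts are at most m, so all its beads lie below c +
-- m. This form of the bound also covers the empty list.
height-beyond : ∀ {m p} c {x} → Decreasing (m ∷ p) → c + + m ≤ x → height c p x ≡ 0ℤ
height-beyond {m} c {x} [-] le₁ = ⁺-nonpos {c - x} (le (nn le₁ ⊕ 0≤+ {m})
    (((∀ u v w → 0ℤ - (u - v) ≡ v - (u + w) + w) ∋ solve-∀) c x (+ m)))
height-beyond {m} {m′ ∷ p} c {x} (m′≤m ∷ L) le₁ = cong₂ _+_
  (θ-no {c - 1ℤ + + m′ - x} (le (nn le₁ ⊕ nn (ℤ.+≤+ m′≤m))
      (((∀ u v w x → 0ℤ - (1ℤ + (u - 1ℤ + v - w)) ≡ w - (u + x) + (x - v)) ∋ solve-∀) c (+ m′) x (+ m))))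
  (height-beyond (c - 1ℤ) L (le (nn le₁ ⊕ nn (ℤ.+≤+ m′≤m) ⊕ 0≤+ {1})
      (((∀ u v w x → u - (v - 1ℤ + w) ≡ u - (v + x) + (x - w) + 1ℤ) ∋ solve-∀) x c (+ m′) (+ m))))

rows-height : ∀ c p → Decreasing p → Height c (height c p)
rows-height c [] L = height-cong (((∀ u → 0ℤ - - u ≡ u) ∋ solve-∀) c)
    (λ x → cong ⁺ { - (x + - c) } {c - x} (((∀ u v → - (u + - v) ≡ v - u) ∋ solve-∀) x c)) (shift (- c) vacuum-height)
rows-height c (m ∷ p) L = record
  { bit = λ x → subst Bit (sym (Δ-cons x)) (go x)
  ; right = right∩ (cong₂ _+_) (c + + m , λ x q → θ-no {c - 1ℤ + + m - x}
      (le (nn q) (((∀ u v w → 0ℤ - (1ℤ + (u - 1ℤ + v - w)) ≡ w - (u + v)) ∋ solve-∀) c (+ m) x))) (right rest)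
  ; left = left∩ (λ {x} q r → trans (cong₂ _+_ q r) (((∀ u v → 1ℤ + (u - 1ℤ - v) ≡ u - v) ∋ solve-∀) c x))
      (c - 1ℤ + + m , λ x q → θ-yes (nn q)) (left rest)
  }
  where
  rest : Height (c - 1ℤ) (height (c - 1ℤ) p)
  rest = rows-height (c - 1ℤ) p (Linked.tail L)
  g : ℤ → ℤ
  g = height (c - 1ℤ) p
  Δ-cons : ∀ x → Δ (height c (m ∷ p)) x ≡ δ (c - 1ℤ + + m - x) + Δ g x
  Δ-cons x = trans {k = (θ (c - 1ℤ + + m - x) - θ (c - 1ℤ + + m - x - 1ℤ)) + Δ g x}
    (cong (λ u → θ (c - 1ℤ + + m - x) + g x - (u + g (1ℤ + x)))
      (cong θ {c - 1ℤ + + m - (1ℤ + x)} {c - 1ℤ + + m - x - 1ℤ}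
          (((∀ u v w → u - 1ℤ + v - (1ℤ + w) ≡ u - 1ℤ + v - w - 1ℤ) ∋ solve-∀) c (+ m) x)))
          (((∀ u v w x → u + v - (w + x) ≡ u - w + (v - x)) ∋ solve-∀) (θ (c - 1ℤ + + m - x)) (g x)
          (θ (c - 1ℤ + + m - x - 1ℤ)) (g (1ℤ + x)))
  go : ∀ x → Bit (δ (c - 1ℤ + + m - x) + Δ g x)
  go x with c - 1ℤ + + m - x ≟ 0ℤ
  ... | no q = subst Bit (trans (sym (+-identityˡ _)) (cong (_+ Δ g x) (sym (δ-no q)))) (bit rest x)
  -- The bead of the first row lies above all beads of the tail, so the two never collide.
  ... | yes q = inj₂ (cong₂ _+_ (cong δ q)
      (cong₂ _-_ (height-beyond (c - 1ℤ) L
      (le (from≡ q) (((∀ u v w → u - (v - 1ℤ + w) ≡ 0ℤ - (v + -1ℤ + w + - u)) ∋ solve-∀) x c (+ m))))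
      (height-beyond (c - 1ℤ) {1ℤ + x} L (le (from≡ q ⊕ 0≤+ {1})
      (((∀ u v w → 1ℤ + u - (v - 1ℤ + w) ≡ 0ℤ - (v + -1ℤ + w + - u) + 1ℤ) ∋ solve-∀) x c (+ m))))))

height-top : ∀ {m p} c → Decreasing (m ∷ p) → height c (m ∷ p) (c - 1ℤ + + m) ≡ 1ℤ
height-top {m} c L = cong₂ _+_ (cong θ {y = 0ℤ} (+-inverseʳ (c - 1ℤ + + m))) (height-beyond (c - 1ℤ) L ≤-refl)

height-above : ∀ {m p} c {x} → Decreasing (m ∷ p) → c + + m ≤ x → height c (m ∷ p) x ≡ 0ℤ
height-above {m} c {x} L q = cong₂ _+_ (θ-no {c - 1ℤ + + m - x}
    (le (nn q) (((∀ u v w → 0ℤ - (1ℤ + (u - 1ℤ + v - w)) ≡ w - (u + v)) ∋ solve-∀) c (+ m) x)))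
    (height-beyond (c - 1ℤ) L (le (nn q ⊕ 0≤+ {1}) (((∀ u v w → u - (v - 1ℤ + w) ≡ u - (v + w) + 1ℤ) ∋ solve-∀) x c
    (+ m))))

Positive : List ℕ → Set
Positive = All (0 ℕ.<_)

-- The topmost bead is the last place where the height is 1, and it determines the first part.
-- Positivity of the parts tells a nonempty list from the empty one.
height-injective : ∀ c {p q} → IsPartition p → IsPartition q → (∀ x → height c p x ≡ height c q x) → p ≡ q
height-injective c {[]} {[]} _ _ e = refl
height-injective c {[]} {m ∷ q} _ (L , m>0 ∷ _) e
  with trans (sym (trans (e _) (height-top c L))) (⁺-nonpos {c - (c - 1ℤ + + m)}
      (le (nn (ℤ.+≤+ m>0)) (((∀ u v → 0ℤ - (u - (u - 1ℤ + v)) ≡ v - (1ℤ + 0ℤ)) ∋ solve-∀) c (+ m))))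
... | ()
height-injective c {m ∷ p} {[]} (L , m>0 ∷ _) _ e
  with trans (sym (trans (sym (e _)) (height-top c L))) (⁺-nonpos {c - (c - 1ℤ + + m)}
      (le (nn (ℤ.+≤+ m>0)) (((∀ u v → 0ℤ - (u - (u - 1ℤ + v)) ≡ v - (1ℤ + 0ℤ)) ∋ solve-∀) c (+ m))))
... | ()
height-injective c {m ∷ p} {m′ ∷ q} (L , _ ∷ Ps) (L′ , _ ∷ Ps′) e with ℕ.<-cmp m m′
... | tri≈ _ refl _ = cong (m ∷_) (height-injective (c - 1ℤ) (Linked.tail L , Ps) (Linked.tail L′ , Ps′)
        λ x → cancel (θ (c - 1ℤ + + m - x)) _ _ (e x))
  where
  cancel : ∀ u v w → u + v ≡ u + w → v ≡ w
  cancel u v w r = trans {j = u + v - u} (((∀ u v → u ≡ v + u - v) ∋ solve-∀) v u)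
      (trans (cong (_- u) r) (((∀ u v → u + v - u ≡ v) ∋ solve-∀) u w))
... | tri< m<m′ _ _ with trans (sym (trans (e _) (height-top c L′)))
    (height-above c L (le (nn (ℤ.+≤+ m<m′)) (((∀ u v w → u + - 1ℤ + v - (u + w) ≡ v - (1ℤ + w)) ∋ solve-∀) c (+ m′)
    (+ m))))
...   | ()
height-injective c {m ∷ p} {m′ ∷ q} (L , _) (L′ , _) e | tri> _ _ m′<m
  with trans (sym (trans (sym (e _)) (height-top c L))) (height-above c L′
      (le (nn (ℤ.+≤+ m′<m)) (((∀ u v w → u + - 1ℤ + v - (u + w) ≡ v - (1ℤ + w)) ∋ solve-∀) c (+ m) (+ m′))))
... | ()

Decreasing-weaken : ∀ {m n p} → m ℕ.≤ n → Decreasing (m ∷ p) → Decreasing (n ∷ p)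
Decreasing-weaken q [-] = [-]
Decreasing-weaken q (r ∷ L) = ℕ.≤-trans r q ∷ L

-- Beads are scanned downwards from x₀ = m - k, above which k of them have been met;
-- a bead at x₀ - 1 gives a part equal to m.
scan : ∀ {f} (h : Height 0ℤ f) n k m x₀ → f x₀ ≡ + k → x₀ ≡ + m - + k → x₀ - + n ≤ proj₁ (left h) →
  ∃ λ p → Decreasing (m ∷ p) × Positive p × (∀ x → x ≤ x₀ → height (- + k) p x ≡ f x - + k)
-- Here m = f x₀ + x₀ is the number of gaps below x₀. When it is zero every position below carries a
-- bead, and only empty rows remain.
scan {f} h n k zero x₀ e₁ e₂ _ = [] , [-] , [] , λ x x≤ → trans
  (⁺-nonneg { - + k - x} (le (nn x≤ ⊕ from≡ e₂) (((∀ u v w → - u - v - 0ℤ ≡ w - v + (0ℤ - u - w)) ∋ solve-∀) (+ k) x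
      x₀)))
  (≤-antisym (le (excess h x) (((∀ u v w → u - v - (- v - w) ≡ u + w - 0ℤ) ∋ solve-∀) (f x) (+ k) x))
             (le (nn (antitone {λ z → - (f z + z)} (λ z → le (nn (Δ≤1 h z))
                 (((∀ u v w → - (u + v) - - (w + (1ℤ + v)) ≡ 1ℤ + w - u) ∋ solve-∀) (f z) z (f (1ℤ + z)))) x≤) ⊕
                 from≡ e₁ ⊕ from≡ e₂) (((∀ u v w x y → - u - v - (w - u) ≡ - (w + v) - - (x + y) + (u - x)
                 + (0ℤ - u - y)) ∋ solve-∀) (+ k) x (f x) (f x₀) x₀)))
-- The fuel n measures the way to the left range. Once x₀ is inside it, f x₀ = - x₀, so no gaps
-- remain below and m would have to be 0.
scan {f} h zero k (suc m) x₀ e₁ e₂ e₃ =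
  absurd (from≡ (sym e₁) ⊕ from≡ (sym e₂) ⊕ from≡ (proj₂ (left h) x₀
      (le (nn e₃) (((∀ u v → u - v ≡ u - (v - 0ℤ)) ∋ solve-∀) (proj₁ (left h)) x₀))) ⊕ 0≤+ {m})
      (((∀ u v w x → u - v + (w - (1ℤ + x - v)) + (0ℤ - w - u) + x ≡ -1ℤ) ∋ solve-∀) (f x₀) (+ k) x₀ (+ m))
scan {f} h (suc n) k (suc m) x₀ e₁ e₂ e₃ = [ gap , bead ]′ (bit h (x₀ - 1ℤ))
  where
  fx₀ : f x₀ ≡ f (1ℤ + (x₀ - 1ℤ))
  fx₀ = cong f (((∀ u → u ≡ 1ℤ + (u - 1ℤ)) ∋ solve-∀) x₀)
  Result : ℕ → ℕ → ℕ → ℤ → Set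
  Result k m n x₀ = ∃ λ p → Decreasing (m ∷ p) × Positive p × (∀ x → x ≤ x₀ → height (- + k) p x ≡ f x - + k)
  gap : Δ f (x₀ - 1ℤ) ≡ 0ℤ → Result k (suc m) n x₀
  gap e with scan h n k m (x₀ - 1ℤ) (eq (ze e ⊞ ze (sym fx₀) ⊞ ze e₁)
      (((∀ u v w x → u - v ≡ 0ℤ - (v - w) + (x - w) + (u - x)) ∋ solve-∀) (+ k) (f (x₀ - 1ℤ)) (f (1ℤ + (x₀ - 1ℤ)))
      (f x₀))) (eq (ze e₂) (((∀ u v w → u - v - (w - 1ℤ) ≡ 1ℤ + u - v - w) ∋ solve-∀) (+ m) (+ k) x₀))
      (le (nn e₃) (((∀ u v w → u - (v - 1ℤ - w) ≡ u - (v - (1ℤ + w))) ∋ solve-∀) (proj₁ (left h)) x₀ (+ n)))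
  ... | p , L , P , H = p , Decreasing-weaken (ℕ.n≤1+n m) L , P , go
    where
    go : ∀ x → x ≤ x₀ → height (- + k) p x ≡ f x - + k
    go x x≤ with ≤-split x≤
    ... | inj₁ refl = trans (height-beyond (- + k) L (le (from≡ (sym e₂) ⊕ 0≤+ {1})
        (((∀ u v w → u - (- v + w) ≡ u - (1ℤ + w + - v) + 1ℤ) ∋ solve-∀) x (+ k) (+ m))))
        (eq (ze (sym e₁)) (((∀ u v → u + - v - 0ℤ ≡ u - v) ∋ solve-∀) (f x) (+ k)))
    ... | inj₂ x< = H x (le (nn x<) (((∀ u v → u + -1ℤ - v ≡ u - (1ℤ + v)) ∋ solve-∀) x₀ x))
  bead : Δ f (x₀ - 1ℤ) ≡ 1ℤ → Result k (suc m) n x₀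
  bead e with scan h n (suc k) (suc m) (x₀ - 1ℤ) (eq (ze e ⊞ ze (sym fx₀) ⊞ ze e₁)
      (((∀ u v w x → 1ℤ + u - v ≡ 1ℤ - (v - w) + (x - w) + (u - x)) ∋ solve-∀) (+ k) (f (x₀ - 1ℤ)) (f (1ℤ + (x₀ - 1ℤ)))
      (f x₀))) (eq (ze e₂) (((∀ u v w → 1ℤ + u - (1ℤ + v) - (w - 1ℤ) ≡ 1ℤ + u - v - w) ∋ solve-∀) (+ m) (+ k) x₀))
      (le (nn e₃) (((∀ u v w → u - (v - 1ℤ - w) ≡ u - (v - (1ℤ + w))) ∋ solve-∀) (proj₁ (left h)) x₀ (+ n)))
  ... | p , L , P , H = suc m ∷ p , ℕ.≤-refl ∷ L , ℕ.s≤s ℕ.z≤n ∷ P , go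
    where
    c≡ : - + k - 1ℤ ≡ - + suc k
    c≡ = (((∀ u → - u - 1ℤ ≡ - (1ℤ + u)) ∋ solve-∀) (+ k))
    go : ∀ x → x ≤ x₀ → height (- + k) (suc m ∷ p) x ≡ f x - + k
    go x x≤ with ≤-split x≤
    ... | inj₁ refl = trans (cong₂ _+_ (θ-no { - + k - 1ℤ + + suc m - x₀}
        (le (from≡ (sym e₂)) (((∀ u v w → 0ℤ - (1ℤ + (- u - 1ℤ + (1ℤ + v) - w)) ≡ w - (1ℤ + v + - u)) ∋ solve-∀) (+ k)
        (+ m) x)))
                        (height-beyond (- + k - 1ℤ) L (le (from≡ (sym e₂) ⊕ 0≤+ {1})
                            (((∀ u v w → u - (- v - 1ℤ + (1ℤ + w)) ≡ u - (1ℤ + w + - v) + 1ℤ) ∋ solve-∀) x (+ k)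
                            (+ m))))) (eq (ze (sym e₁)) (((∀ u v → u + - v - (0ℤ + 0ℤ) ≡ u - v) ∋ solve-∀) (f x) (+ k)))
    ... | inj₂ x< = trans (cong₂ _+_ (θ-yes { - + k - 1ℤ + + suc m - x}
        (le (nn x< ⊕ from≡ e₂) (((∀ u v w x → - u - 1ℤ + (1ℤ + v) - w - 0ℤ ≡ x - (1ℤ + w) + (1ℤ + v + - u - x)) ∋
        solve-∀) (+ k) (+ m) x x₀)))
                        (trans (cong (λ c → height c p x) c≡)
                            (H x (le (nn x<) (((∀ u v → u + -1ℤ - v ≡ u - (1ℤ + v)) ∋ solve-∀) x₀ x)))))
                            (((∀ u v → 1ℤ + (u + - (1ℤ + v)) ≡ u + - v) ∋ solve-∀) (f x) (+ k))

i≤∣i∣ : ∀ i → i ≤ + ∣ i ∣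
i≤∣i∣ (+ n) = ≤-refl
i≤∣i∣ -[1+ n ] = ℤ.-≤+

-∣i∣≤i : ∀ i → - + ∣ i ∣ ≤ i
-∣i∣≤i (+ n) = neg-≤-pos
-∣i∣≤i -[1+ n ] = ≤-refl

realise : ∀ {f} → Height 0ℤ f → ∃ λ p → IsPartition p × (∀ x → height 0ℤ p x ≡ f x)
-- The scan starts at a nonnegative position beyond the right bound, where no bead has been met, so
-- m is that position itself. The fuel leads from there to minus the absolute value of the left
-- bound.
realise {f} h with scan h (∣ proj₁ (right h) ∣ ℕ.+ ∣ proj₁ (left h) ∣) 0 ∣ proj₁ (right h) ∣ (+ ∣ proj₁ (right h) ∣)
    (proj₂ (right h) _ (i≤∣i∣ _)) (((∀ u → u ≡ u - 0ℤ) ∋ solve-∀) (+ ∣ proj₁ (right h) ∣))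
                     (≤-trans (≤-reflexive (((∀ u v → u - (u + v) ≡ - v) ∋ solve-∀) (+ ∣ proj₁ (right h) ∣)
                         (+ ∣ proj₁ (left h) ∣))) (-∣i∣≤i (proj₁ (left h))))
... | p , L , P , H = p , (Linked.tail L , P) , go
  where
  go : ∀ x → height 0ℤ p x ≡ f x
  go x with ≤-or-> x (+ ∣ proj₁ (right h) ∣)
  ... | inj₁ q = trans (H x q) (((∀ u → u + 0ℤ ≡ u) ∋ solve-∀) (f x))
  ... | inj₂ q = trans (height-beyond 0ℤ L (le (nn q ⊕ 0≤+ {1})
      (((∀ u v → u - (0ℤ + v) ≡ u - (1ℤ + v) + 1ℤ) ∋ solve-∀) x (+ ∣ proj₁ (right h) ∣))))
      (sym (proj₂ (right h) x (le (nn q ⊕ nn (i≤∣i∣ (proj₁ (right h))) ⊕ 0≤+ {1})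
      (((∀ u v w → u - v ≡ u - (1ℤ + w) + (w - v) + 1ℤ) ∋ solve-∀) x (proj₁ (right h)) (+ ∣ proj₁ (right h) ∣)))))

height-relative : ∀ {c d x y} p → c - x ≡ d - y → height c p x ≡ height d p y
height-relative [] e = cong ⁺ e
height-relative {c} {d} {x} {y} (m ∷ p) e = cong₂ _+_
  (cong θ {c - 1ℤ + + m - x} {d - 1ℤ + + m - y}
      (eq (ze e) (((∀ u v w x y → u - 1ℤ + v - w - (x - 1ℤ + v - y) ≡ u - w - (x - y)) ∋ solve-∀) d (+ m) y c x)))
  (height-relative {c - 1ℤ} {d - 1ℤ} p (eq {c - 1ℤ - x} {d - 1ℤ - y} (ze e)
      (((∀ u v w x → u - 1ℤ - v - (w - 1ℤ - x) ≡ u - v - (w - x)) ∋ solve-∀) d y c x)))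

-- Contents

occ : ℤ → List ℤ → ℤ
occ r []       = 0ℤ
occ r (y ∷ ys) = δ (y - r) + occ r ys

occ-++ : ∀ r xs ys → occ r (xs ++ ys) ≡ occ r xs + occ r ys
occ-++ r [] ys = sym (+-identityˡ _)
occ-++ r (x ∷ xs) ys = trans (cong (_+_ (δ (x - r))) (occ-++ r xs ys)) (sym (+-assoc (δ (x - r)) (occ r xs) (occ r ys)))

occ≥0 : ∀ r xs → 0ℤ ≤ occ r xs
occ≥0 r [] = ≤-refl
occ≥0 r (x ∷ xs) = bit≥0 (δ-bit (x - r)) ⊕ occ≥0 r xs

occ-↭ : ∀ {xs ys} r → xs ↭ ys → occ r xs ≡ occ r ys
occ-↭ r Perm.refl = refl
occ-↭ r (prep x p) = cong (_+_ (δ (x - r))) (occ-↭ r p)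
occ-↭ {ys = _ ∷ _ ∷ ys} r (swap x y p) = trans {k = δ (y - r) + (δ (x - r) + occ r ys)}
    (cong (λ u → δ (x - r) + (δ (y - r) + u)) (occ-↭ r p)) (((∀ u v w → u + (v + w) ≡ v + (u + w)) ∋ solve-∀)
    (δ (x - r)) (δ (y - r)) (occ r ys))
occ-↭ r (Perm.trans p q) = trans (occ-↭ r p) (occ-↭ r q)

occ-∈ : ∀ {r} xs → 1ℤ ≤ occ r xs → r ∈ xs
occ-∈ {r} (x ∷ xs) p with x - r ≟ 0ℤ
... | yes q = here (sym (i-j≡0⇒i≡j x r q))
... | no q = there (occ-∈ xs (≤-trans p (≤-reflexive (trans (cong (_+ occ r xs) (δ-no q)) (+-identityˡ _)))))
occ-∈ [] (ℤ.+≤+ ())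

occ-head : ∀ x xs → occ x (x ∷ xs) ≡ 1ℤ + occ x xs
occ-head x xs = cong (λ z → δ z + occ x xs) (+-inverseʳ x)

occ-cancel : ∀ r x {xs ys} → occ r (x ∷ xs) ≡ occ r (x ∷ ys) → occ r xs ≡ occ r ys
occ-cancel r x {xs} {ys} e = eq {occ r xs} {occ r ys} {δ (x - r) + occ r ys - (δ (x - r) + occ r xs)} (ze e)
    (((∀ u v w → u - v ≡ w + u - (w + v)) ∋ solve-∀) (occ r ys) (occ r xs) (δ (x - r)))

occ⇒↭ : ∀ xs ys → (∀ r → occ r xs ≡ occ r ys) → xs ↭ ys
occ⇒↭ [] [] e = Perm.refl
occ⇒↭ [] (y ∷ ys) e = absurd (occ≥0 y ys ⊕ from≡ {1ℤ + occ y ys} {0ℤ} (trans (sym (occ-head y ys)) (sym (e y))))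
    (((∀ u → u + (0ℤ - (1ℤ + u)) ≡ -1ℤ) ∋ solve-∀) (occ y ys))
occ⇒↭ (x ∷ xs) ys e with ∈-∃++ (occ-∈ {x} ys (le (from≡ (trans (sym (occ-head x xs)) (e x)) ⊕ occ≥0 x xs)
    (((∀ u v → u - 1ℤ ≡ u - (1ℤ + v) + v) ∋ solve-∀) (occ x ys) (occ x xs))))
... | us , vs , refl = ↭-trans (prep x (occ⇒↭ xs (us ++ vs) λ r → occ-cancel r x {xs} {us ++ vs}
    (trans (e r) (occ-↭ r (↭-shift x us vs))))) (↭-sym (↭-shift x us vs))

-- The deltas telescope. The result says that a row changes the height function by moving one bead
-- from c - 1 to c - 1 + m.
occ-interval : ∀ r c {g} m → (∀ i → g i ≡ c + + i) → occ r (applyUpTo g m) ≡ θ (c - 1ℤ + + m - r) - θ (c - 1ℤ - r)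
occ-interval r c zero e = sym (trans (cong (λ z → θ z - θ (c - 1ℤ - r)) {c - 1ℤ + 0ℤ - r} {c - 1ℤ - r}
    (((∀ u v → u - 1ℤ + 0ℤ - v ≡ u - 1ℤ - v) ∋ solve-∀) c r)) (+-inverseʳ (θ (c - 1ℤ - r))))
occ-interval r c {g} (suc m) e =
  trans (cong₂ _+_ (cong δ {g 0 - r} {c - r}
      (eq (ze (e 0)) (((∀ u v w → u - v - (w - v) ≡ u + 0ℤ - w) ∋ solve-∀) c r (g 0))))
      (occ-interval r (c + 1ℤ) m (λ i → trans (e (suc i)) (((∀ u v → u + (1ℤ + v) ≡ u + 1ℤ + v) ∋ solve-∀) c (+ i)))))
  (trans {j = (θ (c - r) - θ (c - r - 1ℤ)) + (θ (c + 1ℤ - 1ℤ + + m - r) - θ (c + 1ℤ - 1ℤ - r))} refl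
  (trans (cong₂ (λ u v → (θ (c - r) - θ (c - r - 1ℤ)) + (u - v))
      (cong θ {c + 1ℤ - 1ℤ + + m - r} {c - 1ℤ + + suc m - r}
      (((∀ u v w → u + 1ℤ - 1ℤ + v - w ≡ u - 1ℤ + (1ℤ + v) - w) ∋ solve-∀) c (+ m) r))
      (cong θ {c + 1ℤ - 1ℤ - r} {c - r} (((∀ u v → u + 1ℤ - 1ℤ - v ≡ u - v) ∋ solve-∀) c r)))
  (trans (cong (λ u → (θ (c - r) - u) + (θ (c - 1ℤ + + suc m - r) - θ (c - r)))
      (cong θ {c - r - 1ℤ} {c - 1ℤ - r} (((∀ u v → u - v - 1ℤ ≡ u - 1ℤ - v) ∋ solve-∀) c r)))
      (((∀ u v w → u - v + (w - u) ≡ w - v) ∋ solve-∀) (θ (c - r)) (θ (c - 1ℤ - r)) (θ (c - 1ℤ + + suc m - r))))))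

-- Row by row, `occ-interval` moves a bead out of the diagram of all integers below c, whose height
-- is `⁺ (c - r)`. The charge c is what is left of `ck` after a - 1 rows.
occ-residuesFrom : ∀ r ck a c p → c ≡ ck + 1ℤ - + a → occ r (residuesFrom ck a p) + ⁺ (c - r) ≡ height c p r
occ-residuesFrom r ck a c [] e = +-identityˡ _
occ-residuesFrom r ck a c (m ∷ p) e =
  trans (cong₂ _+_ (trans (occ-++ r (map row (upTo m)) (residuesFrom ck (suc a) p))
            (cong (_+ occ r (residuesFrom ck (suc a) p)) (trans (cong (occ r) (map-upTo row m))
                (occ-interval r c m λ i → eq {(+ suc i - + a) + ck} {c + + i} (ze (sym e))
                (((∀ u v w x → u + v - (1ℤ + v - w + x) ≡ u - (x + 1ℤ - w)) ∋ solve-∀) c (+ i) (+ a) ck)))))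
          (trans (cong ⁺ {c - r} {1ℤ + (c - 1ℤ - r)} (((∀ u v → u - v ≡ 1ℤ + (u - 1ℤ - v)) ∋ solve-∀) c r))
              (⁺-suc (c - 1ℤ - r))))
  (eq {b = θ (c - 1ℤ + + m - r) + height (c - 1ℤ) p r}
      (ze (occ-residuesFrom r ck (suc a) (c - 1ℤ) p (eq (ze e)
      (((∀ u v w → u + 1ℤ - (1ℤ + v) - (w - 1ℤ) ≡ u + 1ℤ - v - w) ∋ solve-∀) ck (+ a) c))))
      (((∀ u v w x y → u + v - (u - w + x + (y + w)) ≡ v - (x + y)) ∋ solve-∀) (θ (c - 1ℤ + + m - r))
      (height (c - 1ℤ) p r) (θ (c - 1ℤ - r)) (occ r (residuesFrom ck (suc a) p)) (⁺ (c - 1ℤ - r))))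
  where
  row : ℕ → ℤ
  row i = (+ suc i - + a) + ck

-- The sum of the terms `⁺ (c k - r)` does not depend on μ, so equal contents and equal sums of
-- height functions amount to the same.
occ-content : ∀ r {l} (c : Fin l → ℤ) (μ : Multipartition l) →
  occ r (content0 c μ) + sum (λ k → ⁺ (c k - r)) ≡ sum (λ k → height (c k) (lookup μ k) r)
occ-content r c [] = refl
occ-content r c (p ∷ μ) =
  trans (cong (_+ (⁺ (c zero - r) + S)) (occ-++ r (residuesFrom (c zero) 1 p) (content0 (c ∘ suc) μ)))
  (trans {j = (occ r (residuesFrom (c zero) 1 p) + ⁺ (c zero - r)) + (occ r (content0 (c ∘ suc) μ) + S)}
      (((∀ u v w x → u + v + (w + x) ≡ u + w + (v + x)) ∋ solve-∀) (occ r (residuesFrom (c zero) 1 p))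
      (occ r (content0 (λ x → c (suc x)) μ)) (⁺ (c zero - r)) S)
    (cong₂ _+_ (occ-residuesFrom r (c zero) 1 (c zero) p (((∀ u → u ≡ u + 1ℤ - 1ℤ) ∋ solve-∀) (c zero)))
        (occ-content r (c ∘ suc) μ)))
  where
  S = sum (λ k → ⁺ (c (suc k) - r))

heights : ∀ {l} → (Fin l → ℤ) → Multipartition l → Fin l → ℤ → ℤ
heights c μ k = height (c k) (lookup μ k)

content⇒sum : ∀ {l} (c : Fin l → ℤ) μ ν → content0 c ν ↭ content0 c μ → ∀ r →
  sum (λ k → heights c ν k r) ≡ sum (λ k → heights c μ k r)
content⇒sum c μ ν p r = trans (sym (occ-content r c ν)) (trans (cong (_+ sum (λ k → ⁺ (c k - r))) (occ-↭ r p))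
    (occ-content r c μ))

sum⇒content : ∀ {l} (c : Fin l → ℤ) μ ν → (∀ r → sum (λ k → heights c ν k r) ≡ sum (λ k → heights c μ k r)) →
  content0 c ν ↭ content0 c μ
sum⇒content c μ ν h = occ⇒↭ _ _ λ r → eq (ze (h r))
  (trans (lemma (occ r (content0 c μ)) (occ r (content0 c ν)) (sum (λ k → ⁺ (c k - r))))
      (cong₂ _-_ (occ-content r c μ) (occ-content r c ν)))
  where
  lemma : ∀ u v w → u - v ≡ u + w - (v + w)
  lemma = solve-∀

-- Cores and chains

sum-minus : (f g : Fin l → ℤ) → sum (λ k → f k - g k) ≡ sum f - sum g
sum-minus {zero}  f g = refl
sum-minus {suc l} f g = trans (cong (_+_ (f zero - g zero)) (sum-minus (f ∘ suc) (g ∘ suc)))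
  (lemma (f zero) (g zero) (sum (f ∘ suc)) (sum (g ∘ suc)))
  where
  lemma : ∀ u v s t → u - v + (s - t) ≡ u + s - (v + t)
  lemma = solve-∀

sum-nonneg : (f : Fin l → ℤ) → (∀ k → 0ℤ ≤ f k) → 0ℤ ≤ sum f
sum-nonneg {zero}  f h = ≤-refl
sum-nonneg {suc l} f h = h zero ⊕ sum-nonneg (f ∘ suc) (h ∘ suc)

sum-zero : (f : Fin l → ℤ) → (∀ k → 0ℤ ≤ f k) → sum f ≡ 0ℤ → ∀ k → f k ≡ 0ℤ
sum-zero f h e zero = ≤-antisym (≤-trans (le (sum-nonneg (f ∘ suc) (h ∘ suc)) (lemma (f zero) (sum (f ∘ suc))))
    (≤-reflexive e)) (h zero)
  where
  lemma : ∀ u v → u + v - u ≡ v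
  lemma = solve-∀
sum-zero f h e (suc k) = sum-zero (f ∘ suc) (h ∘ suc)
  (≤-antisym (≤-trans (le (h zero) (lemma (f zero) (sum (f ∘ suc)))) (≤-reflexive e)) (sum-nonneg (f ∘ suc) (h ∘ suc)))
      k
  where
  lemma : ∀ u v → u + v - v ≡ u
  lemma = solve-∀

sum-right : (g : Fin l → ℤ → ℤ) → (∀ k → EventuallyRight λ x → g k x ≡ 0ℤ) → EventuallyRight λ x →
  sum (λ k → g k x) ≡ 0ℤ
sum-right {zero}  g h = 0ℤ , λ _ _ → refl
sum-right {suc l} g h = right∩ (cong₂ _+_) (h zero) (sum-right (g ∘ suc) (h ∘ suc))

sum-left : (g : Fin l → ℤ → ℤ) → (∀ k → EventuallyLeft λ x → g k x ≡ 0ℤ) → EventuallyLeft λ x → sum (λ k → g k x) ≡ 0ℤ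
sum-left {zero}  g h = 0ℤ , λ _ _ → refl
sum-left {suc l} g h = left∩ (cong₂ _+_) (h zero) (sum-left (g ∘ suc) (h ∘ suc))

-- Gives the level against which weights are measured below: c k - ϑ is positive on occupied runners
-- and nonpositive on free ones. The induction raises ϑ to c of a free runner and lowers it to just
-- below c of an occupied one.
threshold : (c a : Fin l → ℤ) → (∀ k → Bit (a k)) → (∀ i j → a i ≡ 1ℤ → a j ≡ 0ℤ → 1ℤ + c j ≤ c i) →
  ∃ λ ϑ → ∀ k → (a k ≡ 1ℤ → 1ℤ + ϑ ≤ c k) × (a k ≡ 0ℤ → c k ≤ ϑ)
threshold {zero} c a bits sep = 0ℤ , λ ()
threshold {suc l} c a bits sep with threshold (c ∘ suc) (a ∘ suc) (bits ∘ suc) (λ i j → sep (suc i) (suc j)) | bits zero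
... | ϑ , H | inj₁ e = ϑ ℤ.⊔ c zero , λ
  { zero → (λ e′ → case (trans (sym e) e′)) , λ _ → i≤j⊔i ϑ (c zero)
  ; (suc k) → (λ e′ → le (nn (⊔-lub {c (suc k) - 1ℤ} {ϑ} {c zero}
      (le (nn (proj₁ (H k) e′)) (((∀ u v → u - 1ℤ - v ≡ u - (1ℤ + v)) ∋ solve-∀) (c (suc k)) ϑ))
      (le (nn (sep (suc k) zero e′ e)) (((∀ u v → u - 1ℤ - v ≡ u - (1ℤ + v)) ∋ solve-∀) (c (suc k)) (c zero)))))
      (((∀ u v → u - (1ℤ + v) ≡ u - 1ℤ - v) ∋ solve-∀) (c (suc k)) (ϑ ℤ.⊔ c zero)))
            , λ e′ → ≤-trans (proj₂ (H k) e′) (i≤i⊔j ϑ (c zero)) }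
  where
  case : ∀ {A : Set} → 0ℤ ≡ 1ℤ → A
  case ()
... | ϑ , H | inj₂ e = ϑ ℤ.⊓ (c zero - 1ℤ) , λ
  { zero → (λ _ → le (nn (i⊓j≤j ϑ (c zero - 1ℤ))) (((∀ u v → u - (1ℤ + v) ≡ u - 1ℤ - v) ∋ solve-∀) (c zero)
      (ϑ ℤ.⊓ (c zero - 1ℤ)))) , λ e′ → case (trans (sym e) e′)
  ; (suc k) → (λ e′ → le (nn (proj₁ (H k) e′) ⊕ nn (i⊓j≤i ϑ (c zero - 1ℤ)))
      (((∀ u v w → u - (1ℤ + v) ≡ u - (1ℤ + w) + (w - v)) ∋ solve-∀) (c (suc k)) (ϑ ℤ.⊓ (c zero - 1ℤ)) ϑ))
            , λ e′ → ⊓-glb (proj₂ (H k) e′) (le (nn (sep zero (suc k) e e′))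
                (((∀ u v → u - 1ℤ - v ≡ u - (1ℤ + v)) ∋ solve-∀) (c zero) (c (suc k)))) }
  where
  case : ∀ {A : Set} → 1ℤ ≡ 0ℤ → A
  case ()

-- Multipartitions as families of height functions

component : {μ : Multipartition l} → IsMultipartition μ → ∀ k → IsPartition (lookup μ k)
component {μ = p ∷ μ} (P , _) zero = P
component {μ = p ∷ μ} (_ , M) (suc k) = component M k

assemble : (p : Fin l → List ℕ) → (∀ k → IsPartition (p k)) → IsMultipartition (tabulate p)
assemble {zero} p P = tt
assemble {suc l} p P = P zero , assemble (p ∘ suc) (P ∘ suc)

heights-height : (c : Fin l → ℤ) {μ : Multipartition l} → IsMultipartition μ → ∀ k → Height (c k) (heights c μ k)
heights-height c {μ} M k = rows-height (c k) (lookup μ k) (proj₁ (component M k))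

realise-charged : ∀ {c f} → Height c f → ∃ λ p → IsPartition p × (∀ x → height c p x ≡ f x)
realise-charged {c} {f} h = let p , P , e = realise (height-cong (+-inverseʳ c) (λ _ → refl) (shift c h)) in
  p , P , λ x → trans (height-relative {c} {0ℤ} {x} {x - c} p (((∀ u v → u - v ≡ 0ℤ - (v - u)) ∋ solve-∀) c x))
      (trans (e (x - c)) (cong f (((∀ u v → u - v + v ≡ u) ∋ solve-∀) x c)))

realise-all : (c : Fin l → ℤ) (g : Fin l → ℤ → ℤ) → (∀ k → Height (c k) (g k)) →
  ∃ λ ν → IsMultipartition ν × (∀ k x → heights c ν k x ≡ g k x)
realise-all c g h = tabulate p , assemble p (λ k → proj₁ (proj₂ (realise-charged (h k)))) , λ k x →
  trans (cong (λ q → height (c k) q x) (lookup∘tabulate p k)) (proj₂ (proj₂ (realise-charged (h k))) x)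
  where
  p : Fin _ → List ℕ
  p k = proj₁ (realise-charged (h k))

heights-injective : (c : Fin l → ℤ) {μ ν : Multipartition l} → IsMultipartition μ → IsMultipartition ν →
  (∀ k x → heights c μ k x ≡ heights c ν k x) → μ ≡ ν
heights-injective c {μ} {ν} M N e = trans (sym (tabulate∘lookup μ))
  (trans (tabulate-cong λ k → height-injective (c k) (component M k) (component N k) (e k)) (tabulate∘lookup ν))

Chain : (Fin l → ℤ) → (Fin l → ℤ → ℤ) → Set
Chain c F = ∀ i j → c i ≤ c j → ∀ x → Δ (F i) x ≤ Δ (F j) x

-- Among all ways to place a given number of beads on the runners at one position, those of a chain maximise the
-- sum of c over the occupied runners.  Summed over all positions these sums only depend on the charges,
-- so every position is extremal.
module _ (c : Fin l → ℤ) {F G : Fin l → ℤ → ℤ} (hF : ∀ k → Height (c k) (F k)) (hG : ∀ k → Height (c k) (G k))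
         (chain : Chain c F) (sums : ∀ x → sum (λ k → G k x) ≡ sum (λ k → F k x)) where

  private
    potential : ℤ → ℤ
    potential x = sum λ k → c k * (F k x - G k x)

    potential-right : EventuallyRight λ x → potential x ≡ 0ℤ
    potential-right = sum-right _ λ k → right∩ (λ p q → trans (cong₂ (λ u v → c k * (u - v)) p q)
        (((∀ u → u * (0ℤ - 0ℤ) ≡ 0ℤ) ∋ solve-∀) (c k))) (right (hF k)) (right (hG k))

    potential-left : EventuallyLeft λ x → potential x ≡ 0ℤ
    potential-left = sum-left _ λ k → left∩ (λ {x} p q → trans (cong₂ (λ u v → c k * (u - v)) p q)
        (((∀ u v → u * (u - v - (u - v)) ≡ 0ℤ) ∋ solve-∀) (c k) x)) (left (hF k)) (left (hG k))

    Δ-sums : ∀ x → sum (λ k → Δ (G k) x - Δ (F k) x) ≡ 0ℤ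
    Δ-sums x = trans (sum-minus (λ k → Δ (G k) x) (λ k → Δ (F k) x)) (i≡j⇒i-j≡0
      (trans (sum-minus (λ k → G k x) (λ k → G k (1ℤ + x)))
      (trans (cong₂ _-_ (sums x) (sums (1ℤ + x)))
      (sym (sum-minus (λ k → F k x) (λ k → F k (1ℤ + x)))))))

    -- At each position F and G occupy equally many runners, so a common ϑ can be subtracted from
    -- all weights without changing the sum.
    gain : ∀ ϑ x → Δ potential x ≡ sum (λ k → (c k - ϑ) * (Δ (F k) x - Δ (G k) x))
    gain ϑ x = trans (sym (sum-minus (λ k → c k * (F k x - G k x)) (λ k → c k * (F k (1ℤ + x) - G k (1ℤ + x))))) (sym
      (trans (sum-cong-≗ λ k → regroup (c k) ϑ (F k x) (F k (1ℤ + x)) (G k x) (G k (1ℤ + x)))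
      (trans (sum-minus (λ k → c k * (F k x - G k x) - c k * (F k (1ℤ + x) - G k (1ℤ + x)))
          (λ k → ϑ * (Δ (F k) x - Δ (G k) x)))
      (trans (cong (λ u → sum (λ k → c k * (F k x - G k x) - c k * (F k (1ℤ + x) - G k (1ℤ + x))) - u)
        (trans (sym (*-distribˡ-sum ϑ (λ k → Δ (F k) x - Δ (G k) x))) (trans (cong (ϑ *_) flipped) (*-zeroʳ ϑ))))
      (+-identityʳ _)))))
      where
      regroup : ∀ c ϑ a b a′ b′ → (c - ϑ) * ((a - b) - (a′ - b′)) ≡ c * (a - a′) - c * (b - b′) - ϑ *
        ((a - b) - (a′ - b′))
      regroup = solve-∀
      flipped : sum (λ k → Δ (F k) x - Δ (G k) x) ≡ 0ℤ
      flipped = trans (sum-minus (λ k → Δ (F k) x) (λ k → Δ (G k) x))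
          (swap-minus (sum λ k → Δ (G k) x) (sum λ k → Δ (F k) x)
        (trans (sym (sum-minus (λ k → Δ (G k) x) (λ k → Δ (F k) x))) (Δ-sums x)))
        where
        swap-minus : ∀ u v → u - v ≡ 0ℤ → v - u ≡ 0ℤ
        swap-minus u v e = i≡j⇒i-j≡0 (sym (i-j≡0⇒i≡j u v e))

    term : ∀ {u a b} → Bit a → Bit b → (a ≡ 1ℤ → 0ℤ ≤ u) → (a ≡ 0ℤ → u ≤ 0ℤ) → 0ℤ ≤ u * (a - b)
    term {u} (inj₁ refl) (inj₁ refl) p q = ≤-reflexive (((∀ u → 0ℤ ≡ u * (0ℤ - 0ℤ)) ∋ solve-∀) u)
    term {u} (inj₁ refl) (inj₂ refl) p q = le (nn (q refl)) (((∀ u → u * (0ℤ - 1ℤ) - 0ℤ ≡ 0ℤ - u) ∋ solve-∀) u)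
    term {u} (inj₂ refl) (inj₁ refl) p q = le (p refl) (((∀ u → u * (1ℤ - 0ℤ) - 0ℤ ≡ u) ∋ solve-∀) u)
    term {u} (inj₂ refl) (inj₂ refl) p q = ≤-reflexive (((∀ u → 0ℤ ≡ u * (1ℤ - 1ℤ)) ∋ solve-∀) u)

    separated : ∀ x i j → Δ (F i) x ≡ 1ℤ → Δ (F j) x ≡ 0ℤ → 1ℤ + c j ≤ c i
    separated x i j p q with ≤-or-> (c i) (c j)
    ... | inj₂ r = r
    ... | inj₁ r = absurd (nn (chain i j r x) ⊕ from≡ (sym p) ⊕ from≡ q)
        (((∀ u v w x → u + - v - (w + - x) + (w + - x - 1ℤ) + (0ℤ - (u + - v)) ≡ -1ℤ) ∋ solve-∀) (F j x) (F j (+ 1 + x))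
        (F i x) (F i (+ 1 + x)))

    terms≥0 : ∀ x k → let ϑ = proj₁ (threshold c (λ k → Δ (F k) x) (λ k → bit (hF k) x) (separated x)) in
      0ℤ ≤ (c k - ϑ) * (Δ (F k) x - Δ (G k) x)
    terms≥0 x k with threshold c (λ k → Δ (F k) x) (λ k → bit (hF k) x) (separated x)
    ... | ϑ , H = term {c k - ϑ} (bit (hF k) x) (bit (hG k) x)
        (λ e → le (nn (proj₁ (H k) e) ⊕ 0≤+ {1}) (((∀ u v → u - v - 0ℤ ≡ u - (1ℤ + v) + 1ℤ) ∋ solve-∀) (c k) ϑ))
        (λ e → le (nn (proj₂ (H k) e)) (((∀ u v → 0ℤ - (u - v) ≡ v - u) ∋ solve-∀) (c k) ϑ))

    antitone-potential : ∀ x → potential (1ℤ + x) ≤ potential x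
    antitone-potential x = 0≤i-j⇒j≤i (≤-trans (sum-nonneg _ (terms≥0 x)) (≤-reflexive (sym (gain _ x))))

    -- An antitone function that vanishes at both ends is zero, so no position yields a gain.
    potential-zero : ∀ x → potential x ≡ 0ℤ
    potential-zero x = ≤-antisym (antitone-≤ antitone-potential potential-left x)
        (antitone-≥ antitone-potential potential-right x)

    -- The gain at x is a vanishing sum of nonnegative terms, whereas a bead of F facing a gap of G
    -- would contribute c k - ϑ, which is at least 1.
    F≤G : ∀ k x → Δ (F k) x ≤ Δ (G k) x
    F≤G k x = bits-≤ (bit (hF k) x) (bit (hG k) x) contra
      where
      T = threshold c (λ k → Δ (F k) x) (λ k → bit (hF k) x) (separated x)
      zero-term : (c k - proj₁ T) * (Δ (F k) x - Δ (G k) x) ≡ 0ℤ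
      zero-term = sum-zero _ (terms≥0 x) (trans (sym (gain (proj₁ T) x))
          (cong₂ _-_ (potential-zero x) (potential-zero (1ℤ + x)))) k
      contra : Δ (F k) x ≡ 1ℤ → Δ (G k) x ≡ 0ℤ → ⊥
      contra p q = absurd (nn (proj₁ (proj₂ T k) p) ⊕ from≡ (trans (sym (cong₂ (λ u v → (c k - proj₁ T) * (u - v)) p q))
          zero-term)) (lemma (c k) (proj₁ T))
        where
        lemma : ∀ u v → u - (1ℤ + v) + (0ℤ - (u - v) * (1ℤ - 0ℤ)) ≡ -1ℤ
        lemma = solve-∀

    -- By `F≤G` the differences are nonnegative, and they sum to zero because the numbers of
    -- occupied runners agree.
    G≤F : ∀ k x → Δ (G k) x ≤ Δ (F k) x
    G≤F k x = ≤-reflexive (i-j≡0⇒i≡j _ _ (sum-zero _ (λ k → nn (F≤G k x)) (Δ-sums x) k))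

  chain-unique : ∀ k x → F k x ≡ G k x
  chain-unique k x = ≤-antisym
    (le (proj₁ (exchange-bound (hF k) (hG k) (F≤G k) x)) refl)
    (le (proj₁ (exchange-bound (hG k) (hF k) (G≤F k) x)) refl)

-- Cores are the chains

module _ (c : Fin l → ℤ) {μ : Multipartition l} (M : IsMultipartition μ) where

  chain⇒core : Chain c (heights c μ) → IsCore0 c μ
  chain⇒core chain = M , λ ν N p → heights-injective c N M λ k x →
    sym (chain-unique c (heights-height c M) (heights-height c N) chain (content⇒sum c μ ν p) k x)

-- Without such a y the beads of g would be beads of f. Then `exchange-bound` squeezes f - g between
-- 0 and c - d, which is at most 0, so f = g, contrary to the situation at x.
exchange : ExcludedMiddle 0ℓ → ∀ {c d f g x} → Height c f → Height d g → c ≤ d → Δ f x ≡ 1ℤ → Δ g x ≡ 0ℤ →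
  ∃ λ y → Δ g y ≡ 1ℤ × Δ f y ≡ 0ℤ
exchange em {c} {d} {f} {g} {x} hf hg c≤d fx gx with em {∃ λ y → Δ g y ≡ 1ℤ × Δ f y ≡ 0ℤ}
... | yes p = p
... | no ¬p = absurd (nn (proj₂ (bound x)) ⊕ proj₁ (bound (1ℤ + x)) ⊕ nn c≤d ⊕ from≡ (sym fx) ⊕ from≡ gx)
    (((∀ u v w x y z → u - v - (w - x) + (y - z) + (v - u) + (w + - y - 1ℤ) + (0ℤ - (x + - z)) ≡ -1ℤ) ∋ solve-∀) c
    d (f x) (g x) (f (1ℤ + x)) (g (1ℤ + x)))
  where
  bound : ∀ z → 0ℤ ≤ f z - g z × f z - g z ≤ c - d
  bound = exchange-bound hg hf λ y → bits-≤ (bit hg y) (bit hf y) λ p q → ¬p (y , p , q)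

single : Fin l → Fin l → ℤ
single zero    zero    = 1ℤ
single zero    (suc k) = 0ℤ
single (suc i) zero    = 0ℤ
single (suc i) (suc k) = single i k

single-same : (i : Fin l) → single i i ≡ 1ℤ
single-same zero = refl
single-same (suc i) = single-same i

single-other : {i k : Fin l} → i ≢ k → single i k ≡ 0ℤ
single-other {i = zero} {zero} p = ⊥-elim (p refl)
single-other {i = zero} {suc k} p = refl
single-other {i = suc i} {zero} p = refl
single-other {i = suc i} {suc k} p = single-other (p ∘ cong suc)

sum-single : (i : Fin l) → sum (single i) ≡ 1ℤ
sum-single {suc l} zero = cong (_+_ 1ℤ) (zeros l)
  where
  zeros : ∀ l → sum {l} (λ _ → 0ℤ) ≡ 0ℤ
  zeros zero = refl
  zeros (suc l) = trans (+-identityˡ _) (zeros l)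
sum-single (suc i) = trans (+-identityˡ _) (sum-single i)

-- If the chain condition fails at x, `exchange` finds a y where the roles are reversed. Moving a
-- bead from x to y on runner i and one from y to x on runner j preserves all charges and the sum of
-- heights, hence the content, so for a core the move must be trivial.
core⇒chain : ExcludedMiddle 0ℓ → (c : Fin l → ℤ) {μ : Multipartition l} → IsCore0 c μ → Chain c (heights c μ)
core⇒chain {l} em c {μ} (M , unique) i j c≤ x = bits-≤ (bit (hF i) x) (bit (hF j) x) contra
  where
  F = heights c μ
  hF = heights-height c M
  contra : Δ (F i) x ≡ 1ℤ → Δ (F j) x ≡ 0ℤ → ⊥
  contra p q with exchange em (hF i) (hF j) c≤ p q
  -- A trivial move has `θ (y - z)` equal to `θ (x - z)` for all z; taking z = x and z = y gives
  -- both inequalities between x and y.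
  ... | y , p′ , q′ = distinct (≤-antisym
      (0≤i-j⇒j≤i (θ-yes⁻¹ (eq (ze {θ (x - x)} {1ℤ} (cong θ (+-inverseʳ x)) ⊞ ze (moved x))
          (((∀ u v → 1ℤ - u ≡ 1ℤ - v + (0ℤ - (u - v))) ∋ solve-∀) (θ (y - x)) (θ (x - x))))))
      (0≤i-j⇒j≤i (θ-yes⁻¹ (eq (ze {θ (y - y)} {1ℤ} (cong θ (+-inverseʳ y)) ⊞ ze (sym (moved y)))
          (((∀ u v → 1ℤ - u ≡ 1ℤ - v + (v - u - 0ℤ)) ∋ solve-∀) (θ (x - y)) (θ (y - y)))))))
    where
    e : Fin l → ℤ
    e k = single i k - single j k
    m : ℤ → ℤ
    m z = θ (y - z) - θ (x - z)
    distinct : x ≢ y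
    distinct refl with trans (sym p) q′
    ... | ()
    i≢j : i ≢ j
    i≢j refl with trans (sym p) q
    ... | ()
    G : Fin l → ℤ → ℤ
    -- One formula for all runners, as e is 1 at i, -1 at j and 0 elsewhere; since e sums to zero,
    -- so do the changes.
    G k z = F k z + e k * m z
    hG : ∀ k → Height (c k) (G k)
    hG k with i Fin.≟ k | j Fin.≟ k
    ... | yes refl | yes refl = ⊥-elim (i≢j refl)
    ... | yes refl | no r = height-cong refl (λ z → trans (coeff (F k z) (m z))
        (cong₂ (λ u v → F k z + (u - v) * m z) (sym (single-same k)) (sym (single-other r)))) (move-height (hF k) p q′)
      where
      coeff : ∀ u v → u + v ≡ u + (1ℤ - 0ℤ) * v
      coeff = solve-∀
    ... | no r | yes refl = height-cong refl (λ z → trans (coeff (F k z) (θ (y - z)) (θ (x - z)))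
        (cong₂ (λ u v → F k z + (u - v) * m z) (sym (single-other r)) (sym (single-same k)))) (move-height (hF k) p′ q)
      where
      coeff : ∀ u v w → u + (w - v) ≡ u + (0ℤ - 1ℤ) * (v - w)
      coeff = solve-∀
    ... | no r | no r′ = height-cong refl (λ z → trans (coeff (F k z) (m z))
        (cong₂ (λ u v → F k z + (u - v) * m z) (sym (single-other r)) (sym (single-other r′)))) (hF k)
      where
      coeff : ∀ u v → u ≡ u + (0ℤ - 0ℤ) * v
      coeff = solve-∀
    sum-e : sum e ≡ 0ℤ
    sum-e = trans (sum-minus (single i) (single j)) (cong₂ _-_ (sum-single i) (sum-single j))
    sum-G : ∀ z → sum (λ k → G k z) ≡ sum (λ k → F k z)
    sum-G z = trans (sum-cong-≗ λ k → coeff (F k z) (e k) (m z)) (trans (sum-minus (λ k → F k z) (λ k → - m z * e k))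
      (trans (cong (λ u → sum (λ k → F k z) - u) (trans (sym (*-distribˡ-sum (- m z) e))
          (trans (cong (- m z *_) sum-e) (*-zeroʳ (- m z))))) (+-identityʳ _)))
      where
      coeff : ∀ u v w → u + v * w ≡ u - (- w * v)
      coeff = solve-∀
    G≡F : ∀ k z → G k z ≡ F k z
    G≡F k z = let ν , N , H = realise-all c G hG in trans (sym (H k z)) (cong (λ λ′ → heights c λ′ k z)
      (unique ν N (sum⇒content c μ ν λ r → trans (sum-cong-≗ {l} λ k → H k r) (sum-G r))))
    moved : ∀ z → θ (y - z) - θ (x - z) ≡ 0ℤ
    moved z = eq (ze (trans (sym (cong₂ (λ u v → F i z + (u - v) * m z) (single-same i) (single-other (i≢j ∘ sym))))
        (G≡F i z)))
      (coeff (F i z) (m z))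
      where
      coeff : ∀ u v → 0ℤ - v ≡ u - (u + (1ℤ - 0ℤ) * v)
      coeff = solve-∀

-- Finiteness

-- The L1 distance on the n positions from x on; for indicator functions, the number of places where
-- they differ. A bound independent of x and n expresses that they differ in boundedly many places.
distance : (ℤ → ℤ) → (ℤ → ℤ) → ℤ → ℕ → ℤ
distance f g x zero    = 0ℤ
distance f g x (suc n) = + ∣ f x - g x ∣ + distance f g (1ℤ + x) n

distance-cong : ∀ {f f′ g g′} → (∀ x → f x ≡ f′ x) → (∀ x → g x ≡ g′ x) → ∀ x n → distance f g x n ≡ distance f′ g′ x n
distance-cong e e′ x zero = refl
distance-cong e e′ x (suc n) = cong₂ _+_ (cong₂ (λ u v → + ∣ u - v ∣) (e x) (e′ x)) (distance-cong e e′ (1ℤ + x) n)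

distance-sym : ∀ f g x n → distance f g x n ≡ distance g f x n
distance-sym f g x zero = refl
distance-sym f g x (suc n) = cong₂ _+_ (cong +_ (∣i-j∣≡∣j-i∣ (f x) (g x))) (distance-sym f g (1ℤ + x) n)

distance-shift : ∀ f g h x n → distance (λ z → f (z + h)) (λ z → g (z + h)) x n ≡ distance f g (x + h) n
distance-shift f g h x zero = refl
distance-shift f g h x (suc n) = cong (_+_ (+ ∣ f (x + h) - g (x + h) ∣))
  (trans (distance-shift f g h (1ℤ + x) n) (cong (λ y → distance f g y n)
      (((∀ u v → 1ℤ + u + v ≡ 1ℤ + (u + v)) ∋ solve-∀) x h)))

distance≥0 : ∀ f g x n → 0ℤ ≤ distance f g x n
distance≥0 f g x zero = ≤-refl
distance≥0 f g x (suc n) = 0≤+ ⊕ distance≥0 f g (1ℤ + x) n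

abs-triangle : ∀ a b c → + ∣ a - c ∣ ≤ + ∣ a - b ∣ + + ∣ b - c ∣
abs-triangle a b c = ≤-trans (≤-reflexive (cong (λ z → + ∣ z ∣) {a - c} {a - b + (b - c)}
    (((∀ u v w → u - v ≡ u - w + (w - v)) ∋ solve-∀) a c b))) (ℤ.+≤+ (∣i+j∣≤∣i∣+∣j∣ (a - b) (b - c)))

distance-triangle : ∀ f g h x n → distance f h x n ≤ distance f g x n + distance g h x n
distance-triangle f g h x zero = ≤-refl
distance-triangle f g h x (suc n) = ≤-trans (+-mono-≤ (abs-triangle (f x) (g x) (h x))
    (distance-triangle f g h (1ℤ + x) n))
  (≤-reflexive (lemma (+ ∣ f x - g x ∣) (+ ∣ g x - h x ∣) (distance f g (1ℤ + x) n) (distance g h (1ℤ + x) n)))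
  where
  lemma : ∀ a b c d → a + b + (c + d) ≡ (a + c) + (b + d)
  lemma = solve-∀

distance-+ : ∀ f g x m n → distance f g x (m ℕ.+ n) ≡ distance f g x m + distance f g (x + + m) n
distance-+ f g x zero n = trans (cong (λ y → distance f g y n) (((∀ u → u ≡ u + 0ℤ) ∋ solve-∀) x)) (sym (+-identityˡ _))
distance-+ f g x (suc m) n = trans (cong (_+_ (+ ∣ f x - g x ∣)) (trans (distance-+ f g (1ℤ + x) m n)
  (cong (λ y → distance f g (1ℤ + x) m + distance f g y n) {1ℤ + x + + m} {x + + suc m}
      (((∀ u v → 1ℤ + u + v ≡ u + (1ℤ + v)) ∋ solve-∀) x (+ m)))))
  (sym (+-assoc (+ ∣ f x - g x ∣) (distance f g (1ℤ + x) m) (distance f g (x + + suc m) n)))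

distance-nested : ∀ {c d f g} → Height c f → Height d g → (∀ x → Δ f x ≤ Δ g x) → ∀ x n →
  distance (Δ f) (Δ g) x n ≤ d - c
distance-nested {c} {d} {f} {g} hf hg f≤g x n =
  le (nn (proj₂ (exchange-bound hf hg f≤g x)) ⊕ proj₁ (exchange-bound hf hg f≤g (x + + n)) ⊕ from≡ (telescope x n))
      (((∀ u v w x y z a → u - v - w ≡ u - v - (x - y) + (z - a) + (x - y - (z - a) - w)) ∋ solve-∀) d c
      (distance (Δ f) (Δ g) x n) (g x) (f x) (g (x + + n)) (f (x + + n)))
  where
  telescope : ∀ x n → distance (Δ f) (Δ g) x n ≡ g x - f x - (g (x + + n) - f (x + + n))
  telescope x zero = trans (sym (+-inverseʳ (g x - f x))) (cong (λ y → g x - f x - (g y - f y)) {x} {x + 0ℤ}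
      (((∀ u → u ≡ u + 0ℤ) ∋ solve-∀) x))
  telescope x (suc n) = trans (cong₂ _+_ (∣-∣-≤ (f≤g x)) (telescope (1ℤ + x) n))
    (trans (cong (λ y → Δ g x - Δ f x + (g (1ℤ + x) - f (1ℤ + x) - (g y - f y))) {1ℤ + x + + n} {x + + suc n}
        (((∀ u v → 1ℤ + u + v ≡ u + (1ℤ + v)) ∋ solve-∀) x (+ n)))
        (((∀ u v w x y z → u - v - (w - x) + (v - x - (y - z)) ≡ u - w - (y - z)) ∋ solve-∀) (g x) (g (1ℤ + x)) (f x)
        (f (1ℤ + x)) (g (x + + suc n)) (f (x + + suc n))))

variation-≥ : ∀ (b : ℤ → ℤ) x n → + ∣ b x - b (x + + n) ∣ ≤ distance b (λ z → b (z + 1ℤ)) x n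
variation-≥ b x zero = ≤-reflexive
    (cong (λ z → + ∣ z ∣) (trans (cong (λ y → b x - b y) {x + 0ℤ} {x} (((∀ u → u + 0ℤ ≡ u) ∋ solve-∀) x))
    (+-inverseʳ (b x))))
variation-≥ b x (suc n) = ≤-trans (abs-triangle (b x) (b (x + 1ℤ)) (b (x + + suc n)))
    (+-monoʳ-≤ (+ ∣ b x - b (x + 1ℤ) ∣)
  (≤-trans (≤-reflexive (cong₂ (λ y z → + ∣ b y - b z ∣) {x + 1ℤ} {1ℤ + x} {x + + suc n} {1ℤ + x + + n}
      (((∀ u → u + 1ℤ ≡ 1ℤ + u) ∋ solve-∀) x) (((∀ u v → u + (1ℤ + v) ≡ 1ℤ + u + v) ∋ solve-∀) x (+ n))))
      (variation-≥ b (1ℤ + x) n)))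

-- A set b that is closed under subtracting S and has a gap at x and a bead at x + ρ + q S
-- changes from gap to bead in each of q consecutive windows of length S.
module _ {b : ℤ → ℤ} (bits : ∀ x → Bit (b x)) {ρ e : ℕ} (closed : ∀ x → b x ≡ 1ℤ → b (x - + (ρ ℕ.+ e)) ≡ 1ℤ) where
  private
    S = ρ ℕ.+ e

    closed* : ∀ q x → b (x + + (q ℕ.* S)) ≡ 1ℤ → b x ≡ 1ℤ
    closed* zero x p = subst (λ y → b y ≡ 1ℤ) (+-identityʳ x) p
    closed* (suc q) x p = closed* q x (subst (λ y → b y ≡ 1ℤ) {x + + (S ℕ.+ q ℕ.* S) - + S} {x + + (q ℕ.* S)}
        (((∀ u v w → u + (v + w) - v ≡ u + w) ∋ solve-∀) x (+ S) (+ (q ℕ.* S))) (closed _ p))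

    gap-up : ∀ x → b x ≡ 0ℤ → b (x + + S) ≡ 0ℤ
    gap-up x p with bits (x + + S)
    ... | inj₁ q = q
    ... | inj₂ q with trans (sym p) (subst (λ y → b y ≡ 1ℤ) {x + + S - + S} {x}
        (((∀ u v → u + v - v ≡ u) ∋ solve-∀) x (+ S)) (closed _ q))
    ... | ()

  variation-windows : ∀ q x → b x ≡ 0ℤ → b (x + + ρ + + (q ℕ.* S)) ≡ 1ℤ →
    + q ≤ distance b (λ z → b (z + 1ℤ)) x (q ℕ.* S)
  variation-windows zero x p r = ≤-refl
  variation-windows (suc q) x p r = ≤-trans (+-mono-≤ first (variation-windows q (x + + S) (gap-up x p)
      (subst (λ y → b y ≡ 1ℤ) {x + + ρ + + (S ℕ.+ q ℕ.* S)} {x + + S + + ρ + + (q ℕ.* S)}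
          (((∀ u v w x → u + v + (w + x) ≡ u + w + v + x) ∋ solve-∀) x (+ ρ) (+ S) (+ (q ℕ.* S))) r)))
    (≤-reflexive (sym (distance-+ b _ x S (q ℕ.* S))))
    where
    first : 1ℤ ≤ distance b (λ z → b (z + 1ℤ)) x S
    -- Closedness pulls the bead at the far end down to x + ρ, so a change occurs among the first ρ
    -- steps of this window; the other e steps can only add.
    first = ≤-trans (≤-reflexive (sym (cong₂ (λ u v → + ∣ u - v ∣) p (closed* (suc q) (x + + ρ) r))))
      (≤-trans (variation-≥ b x ρ) (≤-trans (le (distance≥0 b (λ z → b (z + 1ℤ)) (x + + ρ) e)
          (lemma (distance b (λ z → b (z + 1ℤ)) x ρ) _)) (≤-reflexive (sym (distance-+ b _ x ρ e)))))
      where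
      lemma : ∀ u v → u + v - u ≡ v
      lemma = solve-∀

-- Write y - x = ρ + q (s + 1) by division with remainder. Each of the q windows costs one change,
-- so q is at most C, and ρ is less than s + 1.
gap-bead-bound : ∀ {b : ℤ → ℤ} → (∀ x → Bit (b x)) → ∀ s → (∀ x → b x ≡ 1ℤ → b (x - + suc s) ≡ 1ℤ) →
  ∀ C → (∀ x n → distance b (λ z → b (z + 1ℤ)) x n ≤ + C) → ∀ {x y} → b x ≡ 0ℤ → b y ≡ 1ℤ → y - x ≤ + (suc C ℕ.* suc s)
gap-bead-bound {b} bits s closed C bound {x} {y} bx by with ≤-or-> y x
... | inj₁ y≤x = ≤-trans (i≤j⇒i-j≤0 y≤x) 0≤+
... | inj₂ x<y with ≤⇒+ {x} {y} (≤-trans (i≤suc[i] x) x<y)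
...   | n , refl = ≤-trans (≤-reflexive (lemma x (+ n))) (ℤ.+≤+
    (ℕ.≤-trans (ℕ.≤-reflexive n≡) (ℕ.+-mono-≤ (ℕ.<⇒≤ (ℕ.m%n<n n (suc s))) (ℕ.*-monoˡ-≤ (suc s) (drop‿+≤+ q≤C)))))
  where
  lemma : ∀ x n → x + n - x ≡ n
  lemma = solve-∀
  q = n ℕ./ suc s
  ρ = n ℕ.% suc s
  n≡ : n ≡ ρ ℕ.+ q ℕ.* suc s
  n≡ = ℕ.m≡m%n+[m/n]*n n (suc s)
  split : suc s ≡ ρ ℕ.+ (suc s ℕ.∸ ρ)
  split = sym (ℕ.m+[n∸m]≡n (ℕ.<⇒≤ (ℕ.m%n<n n (suc s))))
  q≤C : + q ≤ + C
  q≤C = ≤-trans (variation-windows bits {ρ} {suc s ℕ.∸ ρ} (subst (λ S → ∀ x → b x ≡ 1ℤ → b (x - + S) ≡ 1ℤ) split closed)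
      q x bx
          (subst (λ z → b z ≡ 1ℤ) (trans (cong (λ k → x + + k) (trans n≡ (cong (λ S → ρ ℕ.+ q ℕ.* S) split)))
              (sym (+-assoc x (+ ρ) _))) by))
        (bound x (q ℕ.* (ρ ℕ.+ (suc s ℕ.∸ ρ))))

-- P is a subgroup containing S, and Euclid's descent applies: a positive element of P either
-- divides all of S, and is then 1, or some element of S leaves a smaller nonzero remainder, again
-- in P.
gcd-generates : ExcludedMiddle 0ℓ → (P S : ℤ → Set) → (∀ x → S x → P x) →
  P 0ℤ → (∀ x → P x → P (- x)) → (∀ x y → P x → P y → P (x + y)) → IsGcdOf S 1 → P 1ℤ
gcd-generates em P S S⊆P P0 P- P+ (_ , greatest) with em {∃ λ x → S x × x ≢ 0ℤ}
-- If S has no nonzero element, 0 is a common divisor, but it does not divide 1.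
... | no none with greatest 0 (λ x s → ℕ.divides 0 (cong ∣_∣ (all-zero x s)))
  where
  all-zero : ∀ x → S x → x ≡ 0ℤ
  all-zero x s = decidable-stable (x ≟ 0ℤ) λ x≢0 → none (x , s , x≢0)
...   | ℕ.divides q e with trans e (ℕ.*-zeroʳ q)
...     | ()
gcd-generates em P S S⊆P P0 P- P+ (_ , greatest) | yes (x , s , x≢0) = descend ∣ x ∣ (x≢0 ∘ ∣i∣≡0⇒i≡0)
    (P-abs x (S⊆P x s))
  where
  P-abs : ∀ x → P x → P (+ ∣ x ∣)
  P-abs (+ n) p = p
  P-abs -[1+ n ] p = P- _ p

  P-* : ∀ n x → P x → P (+ n * x)
  P-* zero x p = P0
  P-* (suc n) x p = subst P (trans (cong (_+ + n * x) (sym (*-identityˡ x))) (sym (*-distribʳ-+ x 1ℤ (+ n))))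
      (P+ _ _ p (P-* n x p))

  P-*ℤ : ∀ i x → P x → P (i * x)
  P-*ℤ (+ n) x p = P-* n x p
  P-*ℤ -[1+ n ] x p = subst P (neg-distribˡ-* (+ suc n) x) (P- _ (P-* (suc n) x p))

  descend : ∀ n → n ≢ 0 → P (+ n) → P 1ℤ
  descend = <-rec _ step
    where
    step : ∀ n → (∀ {m} → m ℕ.< n → m ≢ 0 → P (+ m) → P 1ℤ) → n ≢ 0 → P (+ n) → P 1ℤ
    step zero rec n≢0 p = ⊥-elim (n≢0 refl)
    step (suc n) rec n≢0 p with em {∃ λ y → S y × ¬ suc n ℕ.∣ ∣ y ∣}
    ... | no none = subst (P ∘ +_) (ℕ.∣1⇒≡1 (greatest (suc n) divides-all)) p
      where
      divides-all : ∀ y → S y → suc n ℕ.∣ ∣ y ∣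
      divides-all y s = decidable-stable (suc n ℕ.∣? ∣ y ∣) λ ¬d → none (y , s , ¬d)
    ... | yes (y , s , ¬d) = rec (ℤ.n%ℕd<d y (suc n)) r≢0 (subst P r≡ (P+ _ _ (S⊆P y s) (P- _ (P-*ℤ q (+ suc n) p))))
      where
      q = y ℤ./ℕ suc n
      r = y ℤ.%ℕ suc n
      y≡ : y ≡ + r + q * + suc n
      y≡ = ℤ.a≡a%ℕn+[a/ℕn]*n y (suc n)
      r≡ : y + - (q * + suc n) ≡ + r
      r≡ = eq {e = + r + q * + suc n - y} (ze y≡) (lemma y (+ r) (q * + suc n))
        where
        lemma : ∀ y r z → r - (y + - z) ≡ r + z - y
        lemma = solve-∀
      r≢0 : r ≢ 0
      r≢0 e = ¬d (ℕ.divides ∣ q ∣ (trans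
          (cong ∣_∣ (trans y≡ (trans (cong (λ k → + k + q * + suc n) e) (+-identityˡ (q * + suc n)))))
          (∣i*j∣≡∣i∣*∣j∣ q (+ suc n))))

-- Enumerating partitions with bounded beads and gaps

lists : ℕ → ℕ → List (List ℕ)
lists m zero    = [] ∷ []
lists m (suc n) = [] ∷ cartesianProductWith _∷_ (upTo m) (lists m n)

∈-lists : ∀ m n p → length p ℕ.≤ n → All (ℕ._< m) p → p ∈ lists m n
∈-lists m zero [] _ _ = here refl
∈-lists m (suc n) [] _ _ = here refl
∈-lists m (suc n) (x ∷ p) (ℕ.s≤s len) (x< ∷ p<) = there (∈-cartesianProductWith⁺ _∷_ (∈-upTo⁺ x<)
    (∈-lists m n p len p<))

vectors : {A : Set} → (Fin l → List A) → List (Vec A l)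
vectors {zero}  L = [] ∷ []
vectors {suc l} L = cartesianProductWith _∷_ (L zero) (vectors (L ∘ suc))

∈-vectors : {A : Set} (L : Fin l → List A) (v : Vec A l) → (∀ k → lookup v k ∈ L k) → v ∈ vectors L
∈-vectors L [] h = here refl
∈-vectors L (x ∷ v) h = ∈-cartesianProductWith⁺ _∷_ (h zero) (∈-vectors (L ∘ suc) v (h ∘ suc))

-- The range ends one place above c - length p, so that both values entering `Δ` at the gap c -
-- length p are covered. All rows count there because they are positive.
height-below : ∀ c p x → All (0 ℕ.<_) p → x ≤ c - + length p + 1ℤ → height c p x ≡ + length p + ⁺ (c - + length p - x)
height-below c [] x [] le₁ = trans (cong ⁺ {c - x} {c - 0ℤ - x} (((∀ u v → u - v ≡ u - 0ℤ - v) ∋ solve-∀) c x))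
    (sym (+-identityˡ _))
height-below c (m ∷ p) x (m>0 ∷ P) le₁ = trans (cong₂ _+_
    (θ-yes {c - 1ℤ + + m - x} (le (nn {x} {c - + suc (length p) + 1ℤ} le₁ ⊕ nn (ℤ.+≤+ m>0) ⊕ 0≤+ {length p})
        (((∀ u v w x → u - 1ℤ + v - w - 0ℤ ≡ u - (1ℤ + x) + 1ℤ - w + (v - (1ℤ + 0ℤ)) + x) ∋ solve-∀) c (+ m) x
        (+ length p))))
    (height-below (c - 1ℤ) p x P (≤-trans le₁ (≤-reflexive {c - + suc (length p) + 1ℤ}
        (((∀ u v → u - (1ℤ + v) + 1ℤ ≡ u - 1ℤ - v + 1ℤ) ∋ solve-∀) c (+ length p))))))
  (trans (cong (λ z → 1ℤ + (+ length p + ⁺ z)) {c - 1ℤ - + length p - x} {c - + suc (length p) - x}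
      (((∀ u v w → u - 1ℤ - v - w ≡ u - (1ℤ + v) - w) ∋ solve-∀) c (+ length p) x))
      (sym (+-assoc 1ℤ (+ length p) (⁺ (c - + suc (length p) - x)))))

gap-below : ∀ c p → All (0 ℕ.<_) p → Δ (height c p) (c - + length p) ≡ 0ℤ
gap-below c p P = trans (cong₂ _-_ (height-below c p (c - + length p) P
    (le (0≤+ {1}) (((∀ u v → u - v + 1ℤ - (u - v) ≡ 1ℤ) ∋ solve-∀) c (+ length p))))
    (height-below c p (1ℤ + (c - + length p)) P (≤-reflexive
    (((∀ u v → 1ℤ + (u - v) ≡ u - v + 1ℤ) ∋ solve-∀) c (+ length p)))))
  (trans (cong₂ (λ u v → + length p + ⁺ u - (+ length p + ⁺ v)) {c - + length p - (c - + length p)} {0ℤ}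
      {c - + length p - (1ℤ + (c - + length p))} { -1ℤ} (+-inverseʳ (c - + length p))
      (((∀ u v → u - v - (1ℤ + (u - v)) ≡ -1ℤ) ∋ solve-∀) c (+ length p))) (+-inverseʳ (+ length p + 0ℤ)))

bead-top : ∀ {m p} c → Decreasing (m ∷ p) → Δ (height c (m ∷ p)) (c - 1ℤ + + m) ≡ 1ℤ
bead-top {m} c L = cong₂ _-_ (height-top c L) (height-above c L
    (≤-reflexive (((∀ u v → u + v ≡ 1ℤ + 0ℤ + (u + - 1ℤ + v)) ∋ solve-∀) c (+ m))))

Decreasing-bound : ∀ {m p} → Decreasing (m ∷ p) → All (ℕ._≤ m) (m ∷ p)
Decreasing-bound [-] = ℕ.≤-refl ∷ []
Decreasing-bound (r ∷ L) = ℕ.≤-refl ∷ All.map (λ s → ℕ.≤-trans s r) (Decreasing-bound L)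

-- In charge 0 there is a gap at minus the number of rows, which bounds that number by N. The top
-- bead is the first part minus 1, so parts are at most N + 1.
partition-bounded : ∀ N {p} → IsPartition p → (∀ x → Δ (height 0ℤ p) x ≡ 1ℤ → x ≤ + N) →
  (∀ x → Δ (height 0ℤ p) x ≡ 0ℤ → - + N ≤ x) →
  p ∈ lists (suc (suc N)) N
partition-bounded N {p} (L , P) beads gaps = ∈-lists _ N p (drop‿+≤+
    (le {+ length p} {+ N} (nn (gaps (0ℤ - + length p) (gap-below 0ℤ p P)))
    (((∀ u v → u - v ≡ 0ℤ - v - - u) ∋ solve-∀) (+ N) (+ length p)))) (parts p L beads)
  where
  parts : ∀ p → Decreasing p → (∀ x → Δ (height 0ℤ p) x ≡ 1ℤ → x ≤ + N) → All (ℕ._< suc (suc N)) p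
  parts [] _ _ = []
  parts (m ∷ p) L beads = All.map
      (λ r → ℕ.s≤s (ℕ.≤-trans r (drop‿+≤+ (le {+ m} {+ suc N} (nn (beads (0ℤ - 1ℤ + + m) (bead-top 0ℤ L)))
      (((∀ u v → 1ℤ + u - v ≡ u - (0ℤ - 1ℤ + v)) ∋ solve-∀) (+ N) (+ m)))))) (Decreasing-bound L)

-- Uniform bounds for simultaneous cores

module _ (em : ExcludedMiddle 0ℓ) {T : Set} (c : T → Fin l → ℤ) where

  -- Charge 0 makes the coordinates independent of t: place x here is place x + c t i in the diagram
  -- for c t.
  bead : Multipartition l → Fin l → ℤ → ℤ
  bead μ i = Δ (height 0ℤ (lookup μ i))

  module _ {μ : Multipartition l} (core : SimCore c μ) where
    height₀ : ∀ i → Height 0ℤ (height 0ℤ (lookup μ i))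
    height₀ i = rows-height 0ℤ _ (proj₁ (component (proj₁ core) i))

    bead-bit : ∀ i x → Bit (bead μ i x)
    bead-bit i = bit (height₀ i)

    -- The chain condition for c t at the place x + c t i, which runner j sees as x + (c t i - c t
    -- j).
    edge : ∀ t i j → c t i ≤ c t j → ∀ x → bead μ i x ≤ bead μ j (x + (c t i - c t j))
    edge t i j le₁ x = ≤-trans (≤-reflexive (relative i x (x + c t i) (((∀ u v → u ≡ u + v - v) ∋ solve-∀) x (c t i))))
      (≤-trans (core⇒chain em (c t) (proj₂ core t) i j le₁ (x + c t i))
      (≤-reflexive (sym (relative j (x + (c t i - c t j)) (x + c t i)
          (((∀ u v w → u + (v - w) ≡ u + v - w) ∋ solve-∀) x (c t i) (c t j))))))
      where
      relative : ∀ i x y → x ≡ y - c t i → bead μ i x ≡ Δ (heights (c t) μ i) y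
      relative i x y refl = cong₂ _-_ (height-relative {0ℤ} {c t i} (lookup μ i)
          (((∀ u v → 0ℤ - (u - v) ≡ v - u) ∋ solve-∀) y (c t i)))
          (height-relative {0ℤ} {c t i} (lookup μ i) (((∀ u v → 0ℤ - (1ℤ + (u - v)) ≡ v - (1ℤ + u)) ∋ solve-∀) y
          (c t i)))

    edge-bead : ∀ t i j → c t i ≤ c t j → ∀ x → bead μ i x ≡ 1ℤ → bead μ j (x + (c t i - c t j)) ≡ 1ℤ
    edge-bead t i j le₁ x p = ≤-antisym (bit≤1 (bead-bit j _)) (≤-trans (≤-reflexive (sym p)) (edge t i j le₁ x))

    edge-gap : ∀ t i j → c t i ≤ c t j → ∀ x → bead μ j x ≡ 0ℤ → bead μ i (x - (c t i - c t j)) ≡ 0ℤ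
    edge-gap t i j le₁ x p = ≤-antisym (≤-trans (edge t i j le₁ _)
        (≤-reflexive (trans (cong (bead μ j) (((∀ u v w → u - (v - w) + (v - w) ≡ u) ∋ solve-∀) x (c t i) (c t j))) p)))
        (bit≥0 (bead-bit i _))

    module _ i R (bound : ∀ {x y} → bead μ i x ≡ 0ℤ → bead μ i y ≡ 1ℤ → y - x ≤ + R) where
      -- A bead at x ≥ 0 is outside the vacuum, so by equality of charges there is a gap at some y <
      -- 0, and x is at most R + y.
      bead-≤ : ∀ x → bead μ i x ≡ 1ℤ → x ≤ + R
      bead-≤ x p with ≤-or-> 0ℤ x
      ... | inj₂ x<0 = le (nn x<0 ⊕ 0≤+ {1} ⊕ 0≤+ {R}) (((∀ u v → u - v ≡ 0ℤ - (1ℤ + v) + 1ℤ + u) ∋ solve-∀) (+ R) x)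
      ... | inj₁ 0≤x with exchange em (height₀ i) vacuum-height ≤-refl p
          (trans (Δ-vacuum x) (θ-no (le (nn 0≤x) (((∀ u → 0ℤ - (1ℤ + (- u + - 1ℤ)) ≡ u - 0ℤ) ∋ solve-∀) x))))
      ...   | y , q , r = le (nn (bound r p) ⊕ θ-yes⁻¹ (trans (sym (Δ-vacuum y)) q) ⊕ 0≤+ {1})
          (((∀ u v w → u - v ≡ u - (v + - w) + (- w + - 1ℤ) + 1ℤ) ∋ solve-∀) (+ R) x y)

      gap-≥ : ∀ x → bead μ i x ≡ 0ℤ → - + R ≤ x
      gap-≥ x p with ≤-or-> 0ℤ x
      ... | inj₁ 0≤x = le (nn 0≤x ⊕ 0≤+ {R}) (((∀ u v → u - - v ≡ u - 0ℤ + v) ∋ solve-∀) x (+ R))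
      ... | inj₂ x<0 with exchange em vacuum-height (height₀ i) ≤-refl
          (trans (Δ-vacuum x) (θ-yes (le (nn x<0) (((∀ u → - u + - 1ℤ - 0ℤ ≡ 0ℤ - (1ℤ + u)) ∋ solve-∀) x)))) p
      ...   | y , q , r with ≤-or-> 0ℤ y
      ...     | inj₁ 0≤y = le (nn (bound p q) ⊕ nn 0≤y) (((∀ u v w → u - - v ≡ v - (w + - u) + (w - 0ℤ)) ∋ solve-∀) x
          (+ R) y)
      ...     | inj₂ y<0 with trans (sym r) (trans (Δ-vacuum y)
          (θ-yes (le (nn y<0) (((∀ u → - u + - 1ℤ - 0ℤ ≡ 0ℤ - (1ℤ + u)) ∋ solve-∀) y))))
      ...       | ()

  -- Runner i agrees with the translate of runner j by h up to boundedly many places. The constant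
  -- is chosen before μ, so it is uniform over all simultaneous cores.
  Near : Fin l → Fin l → ℤ → Set
  Near i j h = ∃ λ C → ∀ {μ} → SimCore c μ → ∀ x n → distance (bead μ i) (λ z → bead μ j (z + h)) x n ≤ C

  near-refl : ∀ i → Near i i 0ℤ
  near-refl i = 0ℤ , λ {μ} _ x n → ≤-reflexive (zero-distance (bead μ i) x n)
    where
    zero-distance : ∀ f x n → distance f (λ z → f (z + 0ℤ)) x n ≡ 0ℤ
    zero-distance f x zero = refl
    zero-distance f x (suc n) = cong₂ _+_ (trans (cong (λ y → + ∣ f x - f y ∣) (+-identityʳ x))
        (cong (λ z → + ∣ z ∣) (+-inverseʳ (f x)))) (zero-distance f (1ℤ + x) n)

  near-sym : ∀ {i j h} → Near i j h → Near j i (- h)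
  near-sym {i} {j} {h} (C , near) = C , λ {μ} core x n → ≤-trans (≤-reflexive
    (trans (distance-sym (bead μ j) _ x n)
    (trans (distance-cong (λ _ → refl) (λ z → cong (bead μ j) {z} {z + - h + h}
        (((∀ u v → u ≡ u + - v + v) ∋ solve-∀) z h)) x n)
    (distance-shift (bead μ i) (λ z → bead μ j (z + h)) (- h) x n)))) (near core (x + - h) n)

  near-trans : ∀ {i j k h h′} → Near i j h → Near j k h′ → Near i k (h + h′)
  near-trans {i} {j} {k} {h} {h′} (C , near) (C′ , near′) = C + C′ , λ {μ} core x n →
    ≤-trans (distance-triangle (bead μ i) (λ z → bead μ j (z + h)) _ x n) (+-mono-≤ (near core x n)
    (≤-trans (≤-reflexive (trans (distance-cong (λ _ → refl)
        (λ z → cong (bead μ k) {z + (h + h′)} {z + h + h′} (((∀ u v w → u + (v + w) ≡ u + v + w) ∋ solve-∀) z h h′)) x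
        n)
      (distance-shift (bead μ j) (λ z → bead μ k (z + h′)) h x n))) (near′ core (x + h) n)))

  near-edge≤ : ∀ t i j → c t i ≤ c t j → Near i j (c t i - c t j)
  near-edge≤ t i j le₁ = _ , λ {μ} core x n → ≤-trans
    (≤-reflexive (distance-cong (λ _ → refl) (λ z → sym (Δ-shift (height 0ℤ (lookup μ j)) (c t i - c t j) z)) x n))
    (distance-nested (height₀ core i) (shift (c t i - c t j) (height₀ core j))
      (λ z → ≤-trans (edge core t i j le₁ z) (≤-reflexive (sym (Δ-shift (height 0ℤ (lookup μ j)) (c t i - c t j) z)))) x
          n)

  near-edge : ∀ t i j → Near i j (c t i - c t j)
  near-edge t i j with ≤-total (c t i) (c t j)
  ... | inj₁ p = near-edge≤ t i j p
  ... | inj₂ p = subst (Near i j) (((∀ u v → - (u - v) ≡ v + - u) ∋ solve-∀) (c t j) (c t i))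
      (near-sym (near-edge≤ t j i p))

  -- Walk from k to j with t, from j to i with u, and from i back to k with t: the entries at k
  -- cancel and the element of `gSet` is left.
  near-gSet : ∀ k x → gSet c x → Near k k x
  near-gSet k x (inj₁ (t , refl)) = near-refl k
  near-gSet k x (inj₂ (t , u , i , j , refl)) = subst (Near k k)
      (((∀ u v w x y → u - v + (w - x + (y - u)) ≡ y - v - x + w) ∋ solve-∀) (c t k) (c t j) (c u j) (c u i) (c t i))
    (near-trans (near-edge t k j) (near-trans (near-edge u j i) (near-edge t i k)))

  -- The translations h with `Near k k h` form a subgroup of the integers.
  near-1 : gIsOne c → ∀ k → Near k k 1ℤ
  near-1 g k = gcd-generates em (Near k k) (gSet c) (near-gSet k) (near-refl k) (λ _ → near-sym) (λ _ _ → near-trans) g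

  -- a cycle i → j → i of positive weight S
  module _ (g : gIsOne c) {i j t u} (t≤ : c t i ≤ c t j) (u≤ : c u j ≤ c u i)
      (S>0 : 1ℤ ≤ (c t j - c t i) + (c u i - c u j)) where
    private
      S = (c t j - c t i) + (c u i - c u j)
      s = ∣ S - 1ℤ ∣
      S≡ : S ≡ + suc s
      S≡ = eq {e = + s - (S - 1ℤ)} (ze (sym (0≤i⇒+∣i∣≡i (nn S>0)))) (lemma S (+ s))
        where
        lemma : ∀ S s → 1ℤ + s - S ≡ s - (S - 1ℤ)
        lemma = solve-∀
      C = proj₁ (near-1 g i)

    cycle-closed : ∀ {μ} → SimCore c μ → ∀ x → bead μ i x ≡ 1ℤ → bead μ i (x - + suc s) ≡ 1ℤ
    cycle-closed {μ} core x p = subst (λ y → bead μ i y ≡ 1ℤ)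
        (trans {j = x - ((c t j - c t i) + (c u i - c u j))}
        (((∀ u v w x y → u + (v - w) + (x - y) ≡ u - (w - v + (y - x))) ∋ solve-∀) x (c t i) (c t j) (c u j) (c u i))
        (cong (λ z → x - z) S≡))
      (edge-bead core u j i u≤ _ (edge-bead core t i j t≤ x p))

    cycle-bound : ∃ λ R → ∀ {μ} → SimCore c μ → ∀ {x y} → bead μ i x ≡ 0ℤ → bead μ i y ≡ 1ℤ → y - x ≤ + R
    cycle-bound = suc ∣ C ∣ ℕ.* suc s , λ core → gap-bead-bound (bead-bit core i) s (cycle-closed core) ∣ C ∣
      (λ x n → ≤-trans (proj₂ (near-1 g i) core x n) (i≤∣i∣ C))

    bead-bounded : ∃ λ R → ∀ {μ} → SimCore c μ → ∀ x → bead μ i x ≡ 1ℤ → x ≤ R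
    bead-bounded = + proj₁ cycle-bound , λ core → bead-≤ core i (proj₁ cycle-bound) (proj₂ cycle-bound core)

    gap-bounded : ∃ λ R → ∀ {μ} → SimCore c μ → ∀ x → bead μ i x ≡ 0ℤ → R ≤ x
    gap-bounded = - + proj₁ cycle-bound , λ core → gap-≥ core i (proj₁ cycle-bound) (proj₂ cycle-bound core)

  finite : gIsOne c → ConditionX c → FiniteSet (SimCore c)
  finite g ((k , (t , k-max) , ¬k-max) , (n , (v , n-min) , ¬n-min)) = vectors L , λ μ core → ∈-vectors L μ λ i →
    partition-bounded (N i) (component (proj₁ core) i)
      -- Since k is maximal at t, an edge leads from every runner i to k and carries its beads to
      -- beads of k.
      (λ x p → ≤-trans {j = proj₁ beads - (c t i - c t k)} (le
          (nn (proj₂ beads core _ (edge-bead core t i k (k-max i) x p)))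
          (((∀ u v w x → u - (v - w) - x ≡ u - (x + (v - w))) ∋ solve-∀) (proj₁ beads) (c t i) (c t k) x))
          (≤-trans (i≤∣i∣ (up i)) (ℤ.+≤+ (ℕ.m≤m+n ∣ up i ∣ ∣ down i ∣))))
      (λ x p → ≤-trans (neg-mono-≤ (ℤ.+≤+ (ℕ.m≤n+m ∣ down i ∣ ∣ up i ∣)))
          (≤-trans (-∣i∣≤i (down i)) (le {proj₁ gaps + (c v n - c v i)}
          (nn (proj₂ gaps core _ (edge-gap core v n i (n-min i) x p)))
          (((∀ u v w x → u - (v + (w - x)) ≡ u - (w - x) - v) ∋ solve-∀) x (proj₁ gaps) (c v n) (c v i)))))
    where
    beads : ∃ λ R → ∀ {μ} → SimCore c μ → ∀ x → bead μ k x ≡ 1ℤ → x ≤ R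
    -- As k is not always maximal, some u and j have c u k < c u j; together with the edge from j
    -- back to k at t this closes a cycle of positive weight.
    beads with decidable-stable (em {∃ λ u → ∃ λ j → 1ℤ + c u k ≤ c u j})
        (λ none → ¬k-max λ u j → [ (λ p → p) , (λ p → ⊥-elim (none (u , j , p))) ]′ (≤-or-> (c u j) (c u k)))
    ... | u , j , p = bead-bounded g {k} {j} {u} {t} (≤-trans (i≤suc[i] _) p) (k-max j)
        (le (nn p ⊕ nn (k-max j)) (((∀ u v w x → u - v + (w - x) - 1ℤ ≡ u - (1ℤ + v) + (w - x)) ∋ solve-∀) (c u j)
        (c u k) (c t k) (c t j)))
    gaps : ∃ λ R → ∀ {μ} → SimCore c μ → ∀ x → bead μ n x ≡ 0ℤ → R ≤ x
    gaps with decidable-stable (em {∃ λ u → ∃ λ j → 1ℤ + c u j ≤ c u n})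
        (λ none → ¬n-min λ u j → [ (λ p → p) , (λ p → ⊥-elim (none (u , j , p))) ]′ (≤-or-> (c u n) (c u j)))
    ... | u , j , p = gap-bounded g {n} {j} {v} {u} (n-min j) (≤-trans (i≤suc[i] _) p)
        (le (nn p ⊕ nn (n-min j)) (((∀ u v w x → u - v + (w - x) - 1ℤ ≡ w - (1ℤ + x) + (u - v)) ∋ solve-∀) (c v j)
        (c v n) (c u n) (c u j)))
    up down : Fin l → ℤ
    up i = proj₁ beads - (c t i - c t k)
    down i = proj₁ gaps + (c v n - c v i)
    N : Fin l → ℕ
    N i = ∣ up i ∣ ℕ.+ ∣ down i ∣
    L : Fin l → List (List ℕ)
    L i = lists (suc (suc (N i))) (N i)

-- Infinite families

infinite : {P : Multipartition l → Set} (f : ℕ → Multipartition l) → (∀ n → P (f n)) →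
  (∀ {m n} → m ℕ.< n → f m ≢ f n) → ¬ FiniteSet P
infinite f Pf distinct (L , complete) with pigeonhole (ℕ.n<1+n (length L))
    (λ i → Any.index (complete (f (toℕ i)) (Pf (toℕ i))))
... | i , j , i<j , e = distinct i<j (trans (lookup-index (complete (f (toℕ i)) (Pf (toℕ i))))
  (trans (cong (List.lookup L) e) (sym (lookup-index (complete (f (toℕ j)) (Pf (toℕ j)))))))

-- The converse of `edge`: charge-0 diagrams that satisfy the translated chain conditions for every
-- t give simultaneous cores, by `chain⇒core`.
module _ {T : Set} (c : T → Fin l → ℤ) (g : ℕ → Fin l → ℤ → ℤ) (hg : ∀ n i → Height 0ℤ (g n i))
  (edges : ∀ n t i j → c t i ≤ c t j → ∀ x → Δ (g n i) x ≤ Δ (g n j) (x + (c t i - c t j)))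
  (k : Fin l) (distinct : ∀ {m n} → m ℕ.< n → ∃ λ x → Δ (g m k) x ≢ Δ (g n k) x) where

  private
    ν : ℕ → Multipartition l
    ν n = proj₁ (realise-all (λ _ → 0ℤ) (g n) (hg n))

    ν-height : ∀ n i x → height 0ℤ (lookup (ν n) i) x ≡ g n i x
    ν-height n = proj₂ (proj₂ (realise-all (λ _ → 0ℤ) (g n) (hg n)))

    relative : ∀ n t i x → Δ (heights (c t) (ν n) i) x ≡ Δ (g n i) (x - c t i)
    relative n t i x = cong₂ _-_
      (trans (height-relative {c t i} {0ℤ} {x} {x - c t i} (lookup (ν n) i)
          (((∀ u v → u - v ≡ 0ℤ - (v - u)) ∋ solve-∀) (c t i) x)) (ν-height n i (x - c t i)))
      (trans (height-relative {c t i} {0ℤ} {1ℤ + x} {1ℤ + (x - c t i)} (lookup (ν n) i)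
          (((∀ u v → u - (1ℤ + v) ≡ 0ℤ - (1ℤ + (v - u))) ∋ solve-∀) (c t i) x)) (ν-height n i (1ℤ + (x - c t i))))

    chain : ∀ n t → Chain (c t) (heights (c t) (ν n))
    chain n t i j le₁ x = ≤-trans (≤-reflexive (relative n t i x)) (≤-trans (edges n t i j le₁ (x - c t i))
      (≤-reflexive (trans (cong (Δ (g n j)) {x - c t i + (c t i - c t j)} {x - c t j}
          (((∀ u v w → u - v + (v - w) ≡ u - w) ∋ solve-∀) x (c t i) (c t j))) (sym (relative n t j x)))))

    simCore : ∀ n → SimCore c (ν n)
    simCore n = M , λ t → chain⇒core (c t) M (chain n t)
      where
      M = proj₁ (proj₂ (realise-all (λ _ → 0ℤ) (g n) (hg n)))

  infinitely-many : ¬ FiniteSet (SimCore c)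
  infinitely-many = infinite ν simCore λ {m} {n} m<n e → proj₂ (distinct m<n) (same m n e (proj₁ (distinct m<n)))
    where
    values : ∀ m n → ν m ≡ ν n → ∀ x → g m k x ≡ g n k x
    values m n e x = trans (sym (ν-height m k x)) (trans (cong (λ μ → height 0ℤ (lookup μ k) x) e) (ν-height n k x))
    same : ∀ m n → ν m ≡ ν n → ∀ x → Δ (g m k) x ≡ Δ (g n k) x
    same m n e x = cong₂ _-_ (values m n e x) (values m n e (1ℤ + x))

-- Families supported on the extremal runners

Δ-vacuum-yes : ∀ x → 1ℤ + x ≤ 0ℤ → Δ vacuum x ≡ 1ℤ
Δ-vacuum-yes x p = trans (Δ-vacuum x) (θ-yes (le (nn p) (((∀ u → - u + - 1ℤ - 0ℤ ≡ 0ℤ - (1ℤ + u)) ∋ solve-∀) x)))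

Δ-vacuum-no : ∀ x → 0ℤ ≤ x → Δ vacuum x ≡ 0ℤ
Δ-vacuum-no x p = trans (Δ-vacuum x) (θ-no (le (nn p) (((∀ u → 0ℤ - (1ℤ + (- u + - 1ℤ)) ≡ u - 0ℤ) ∋ solve-∀) x)))

-- The runners in K carry g n, all others the empty partition.
module _ (em : ExcludedMiddle 0ℓ) {T : Set} (c : T → Fin l → ℤ) (K : Fin l → Set) {k : Fin l} (Kk : K k)
  (g : ℕ → ℤ → ℤ) (hg : ∀ n → Height 0ℤ (g n))
  (distinct : ∀ {m n} → m ℕ.< n → ∃ λ x → Δ (g m) x ≢ Δ (g n) x)
  (inside : ∀ t i j → K i → K j → c t i ≡ c t j)
  (leaving : ∀ t i j → K i → ¬ K j → c t i ≤ c t j → ∀ n x → Δ (g n) x ≤ Δ vacuum (x + (c t i - c t j)))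
  (entering : ∀ t i j → ¬ K i → K j → c t i ≤ c t j → ∀ n x → Δ vacuum x ≤ Δ (g n) (x + (c t i - c t j))) where

  private
    G : ∀ n {i} → Dec (K i) → ℤ → ℤ
    G n (yes _) = g n
    G n (no _)  = vacuum

    hG : ∀ n {i} (d : Dec (K i)) → Height 0ℤ (G n d)
    hG n (yes _) = hg n
    hG n (no _)  = vacuum-height

    edges : ∀ n t i j (d : Dec (K i)) (d′ : Dec (K j)) → c t i ≤ c t j → ∀ x →
      Δ (G n d) x ≤ Δ (G n d′) (x + (c t i - c t j))
    edges n t i j (yes p) (yes q) le₁ x = ≤-reflexive (cong (Δ (g n))
        (eq {x} {x + (c t i - c t j)} (ze (sym (inside t i j p q)))
        (((∀ u v w → u + (v - w) - u ≡ v - w) ∋ solve-∀) x (c t i) (c t j))))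
    edges n t i j (yes p) (no ¬q) le₁ x = leaving t i j p ¬q le₁ n x
    edges n t i j (no ¬p) (yes q) le₁ x = entering t i j ¬p q le₁ n x
    edges n t i j (no ¬p) (no ¬q) le₁ x = bits-≤ (bit vacuum-height x) (bit vacuum-height (x + (c t i - c t j))) λ u v →
        case u v
      where
      case : Δ vacuum x ≡ 1ℤ → Δ vacuum (x + (c t i - c t j)) ≡ 0ℤ → ⊥
      case u v with ≤-or-> 0ℤ x
      ... | inj₁ 0≤x with trans (sym u) (Δ-vacuum-no x 0≤x)
      ...   | ()
      case u v | inj₂ x<0 with trans (sym v) (Δ-vacuum-yes (x + (c t i - c t j))
          (le (nn x<0 ⊕ nn le₁) (((∀ u v w → 0ℤ - (1ℤ + (u + (v - w))) ≡ 0ℤ - (1ℤ + u) + (w - v)) ∋ solve-∀) x (c t i)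
          (c t j))))
      ...   | ()

    distinct-at : (d : Dec (K k)) → ∀ {m n} → m ℕ.< n → ∃ λ x → Δ (G m d) x ≢ Δ (G n d) x
    distinct-at (yes _) = distinct
    distinct-at (no ¬p) = ⊥-elim (¬p Kk)

  extremal-infinite : ¬ FiniteSet (SimCore c)
  extremal-infinite = infinitely-many c (λ n i → G n {i} em) (λ n i → hG n em) (λ n t i j → edges n t i j em em) k
      (distinct-at em)

-- The partition with a single row, of length n + 1.
row : ℕ → ℤ → ℤ
row n = move -1ℤ (+ n) vacuum

row-height : ∀ n → Height 0ℤ (row n)
row-height n = move-height {x = -1ℤ} {+ n} vacuum-height refl (Δ-vacuum-no (+ n) 0≤+)

δ-off : ∀ {x y} → x ≢ y → δ (x - y) ≡ 0ℤ
δ-off {x} {y} p = δ-no (λ e → p (i-j≡0⇒i≡j x y e))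

δ-on : ∀ x → δ (x - x) ≡ 1ℤ
δ-on x = cong δ (+-inverseʳ x)

Δ-move-off : ∀ x y f z → x ≢ z → y ≢ z → Δ (move x y f) z ≡ Δ f z
Δ-move-off x y f z p q = trans (Δ-move x y f z) (trans (cong₂ (λ u v → Δ f z - u + v) (δ-off p) (δ-off q))
    (((∀ u v → u - v - 0ℤ + 0ℤ ≡ u - v) ∋ solve-∀) (f z) (f (1ℤ + z))))

Δ-move-target : ∀ x y f → x ≢ y → Δ (move x y f) y ≡ 1ℤ + Δ f y
Δ-move-target x y f p = trans (Δ-move x y f y) (trans (cong₂ (λ u v → Δ f y - u + v) (δ-off p) (δ-on y))
    (((∀ u v → u - v - 0ℤ + 1ℤ ≡ 1ℤ + (u - v)) ∋ solve-∀) (f y) (f (1ℤ + y))))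

Δ-move-source : ∀ x y f → x ≢ y → Δ (move x y f) x ≡ Δ f x - 1ℤ
Δ-move-source x y f p = trans (Δ-move x y f x) (trans (cong₂ (λ u v → Δ f x - u + v) (δ-on x) (δ-off (p ∘ sym)))
    (((∀ u v → u - v - 1ℤ + 0ℤ ≡ u - v - 1ℤ) ∋ solve-∀) (f x) (f (1ℤ + x))))

row-distinct : ∀ {m n} → m ℕ.< n → ∃ λ x → Δ (row m) x ≢ Δ (row n) x
row-distinct {m} {n} m<n = + n , λ e → case
    (trans (sym (trans (Δ-move-off -1ℤ (+ m) vacuum (+ n) (λ ()) (λ p → ℕ.<⇒≢ m<n (+-injective p)))
    (Δ-vacuum-no (+ n) 0≤+)))
    (trans e (trans (Δ-move-target -1ℤ (+ n) vacuum (λ ())) (cong (_+_ 1ℤ) (Δ-vacuum-no (+ n) 0≤+)))))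
  where
  case : 0ℤ ≢ 1ℤ
  case ()

-- The partition with n + 1 rows of length 1.
column : ℕ → ℤ → ℤ
column n = move -[1+ n ] 0ℤ vacuum

column-height : ∀ n → Height 0ℤ (column n)
column-height n = move-height {x = -[1+ n ]} {0ℤ} vacuum-height
    (Δ-vacuum-yes -[1+ n ] (le (0≤+ {n}) (((∀ u → 0ℤ - (1ℤ + - (1ℤ + u)) ≡ u) ∋ solve-∀) (+ n)))) refl

column-distinct : ∀ {m n} → m ℕ.< n → ∃ λ x → Δ (column m) x ≢ Δ (column n) x
column-distinct {m} {n} m<n = -[1+ n ] , λ e → case
    (trans (sym (trans (Δ-move-off -[1+ m ] 0ℤ vacuum -[1+ n ] (λ p → ℕ.<⇒≢ m<n (-[1+-injective p)) (λ ())) full))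
    (trans e (trans (Δ-move-source -[1+ n ] 0ℤ vacuum (λ ())) (cong (_- 1ℤ) full))))
  where
  full : Δ vacuum -[1+ n ] ≡ 1ℤ
  full = Δ-vacuum-yes -[1+ n ] (le (0≤+ {n}) (((∀ u → 0ℤ - (1ℤ + - (1ℤ + u)) ≡ u) ∋ solve-∀) (+ n)))
  case : 1ℤ ≢ 0ℤ
  case ()

argmax : (f : Fin (suc l) → ℤ) → ∃ λ k → ∀ j → f j ≤ f k
argmax {zero} f = zero , λ { zero → ≤-refl }
argmax {suc l} f with argmax (f ∘ suc)
... | k , max with ≤-total (f zero) (f (suc k))
...   | inj₁ p = suc k , λ { zero → p ; (suc j) → max j }
...   | inj₂ p = zero , λ { zero → ≤-refl ; (suc j) → ≤-trans (max j) p }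

module _ (em : ExcludedMiddle 0ℓ) {T : Set} (c : T → Fin (suc l) → ℤ) (t₀ : T) where

  -- The always maximal runners exist by `argmax` and have equal entries for each t. No edge leaves
  -- them, since its target would be maximal at t, hence always. An edge entering them is strict,
  -- for otherwise its source would be maximal at t.
  rows-infinite : (∀ k → SometimesMax c k → AlwaysMax c k) → ¬ FiniteSet (SimCore c)
  rows-infinite always = extremal-infinite em c (AlwaysMax c) {proj₁ (argmax (c t₀))}
      (always _ (t₀ , proj₂ (argmax (c t₀)))) row row-height row-distinct
    (λ t i j p q → ≤-antisym (q t i) (p t j))
    (λ t i j p ¬q le₁ → ⊥-elim (¬q (always j (t , λ m → ≤-trans (p t m) le₁))))
    entering
    where
    entering : ∀ t i j → ¬ AlwaysMax c i → AlwaysMax c j → c t i ≤ c t j → ∀ n x →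
      Δ vacuum x ≤ Δ (row n) (x + (c t i - c t j))
    entering t i j ¬p q le₁ n x with ≤-split le₁
    ... | inj₁ e = ⊥-elim (¬p (always i (t , λ m → ≤-trans (q t m) (≤-reflexive (sym e)))))
    ... | inj₂ lt with ≤-or-> 0ℤ x
    ...   | inj₁ 0≤x = ≤-trans (≤-reflexive (Δ-vacuum-no x 0≤x)) (bit≥0 (bit (row-height n) (x + (c t i - c t j))))
    -- A strict edge moves a vacuum bead to -2 or below, so it misses the vacated place -1.
    ...   | inj₂ x<0 = ≤-trans (≤-reflexive (Δ-vacuum-yes x x<0)) (≤-reflexive (sym (trans
              (Δ-move-off -1ℤ (+ n) vacuum (x + (c t i - c t j))
                  (λ e → absurd (nn lt ⊕ nn x<0 ⊕ from≡ e)
                  (((∀ u v w → u - (1ℤ + v) + (0ℤ - (1ℤ + w)) + (w + (v - u) - -1ℤ) ≡ -1ℤ) ∋ solve-∀) (c t j) (c t i)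
                  x)) (λ e → absurd (nn lt ⊕ nn x<0 ⊕ from≡ e ⊕ 0≤+ {n} ⊕ 0≤+ {1})
                  (((∀ u v w x → u - (1ℤ + v) + (0ℤ - (1ℤ + w)) + (w + (v - u) - x) + x + 1ℤ ≡ -1ℤ) ∋ solve-∀) (c t j)
                  (c t i) x (+ n))))
              (Δ-vacuum-yes (x + (c t i - c t j)) (le (nn x<0 ⊕ nn lt ⊕ 0≤+ {1})
                  (((∀ u v w → 0ℤ - (1ℤ + (u + (v - w))) ≡ 0ℤ - (1ℤ + u) + (w - (1ℤ + v)) + 1ℤ) ∋ solve-∀) x (c t i)
                  (c t j)))))))

  -- Dually, only edges leaving the always minimal runners matter; they are strict and take even the
  -- extra bead at 0 to a negative place, which is full.
  columns-infinite : (∀ k → SometimesMin c k → AlwaysMin c k) → ¬ FiniteSet (SimCore c)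
  columns-infinite always = extremal-infinite em c (AlwaysMin c) {k}
      (always k (t₀ , λ j → neg-cancel-≤ (proj₂ argmin j))) column column-height column-distinct
    (λ t i j p q → ≤-antisym (p t j) (q t i))
    leaving
    (λ t i j ¬p q le₁ → ⊥-elim (¬p (always i (t , λ m → ≤-trans le₁ (q t m)))))
    where
    argmin = argmax (λ j → - c t₀ j)
    k = proj₁ argmin
    leaving : ∀ t i j → AlwaysMin c i → ¬ AlwaysMin c j → c t i ≤ c t j → ∀ n x →
      Δ (column n) x ≤ Δ vacuum (x + (c t i - c t j))
    leaving t i j p ¬q le₁ n x with ≤-split le₁
    ... | inj₁ e = ⊥-elim (¬q (always j (t , λ m → ≤-trans (≤-reflexive (sym e)) (p t m))))
    ... | inj₂ lt with ≤-or-> 1ℤ x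
    ...   | inj₁ 1≤x = ≤-trans (≤-reflexive
        (trans (Δ-move-off -[1+ n ] 0ℤ vacuum x (λ e → absurd (nn 1≤x ⊕ from≡ (sym e) ⊕ 0≤+ {n} ⊕ 0≤+ {1})
        (((∀ u v → u - 1ℤ + (- (1ℤ + v) - u) + v + 1ℤ ≡ -1ℤ) ∋ solve-∀) x (+ n)))
        (λ e → absurd (nn 1≤x ⊕ from≡ (sym e)) (((∀ u → u - 1ℤ + (0ℤ - u) ≡ -1ℤ) ∋ solve-∀) x)))
              (Δ-vacuum-no x (le (nn 1≤x ⊕ 0≤+ {1}) (((∀ u → u - 0ℤ ≡ u - 1ℤ + 1ℤ) ∋ solve-∀) x)))))
                  (bit≥0 (bit vacuum-height (x + (c t i - c t j))))
    ...   | inj₂ x<1 = ≤-trans (bit≤1 (bit (column-height n) x))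
        (≤-reflexive (sym (Δ-vacuum-yes (x + (c t i - c t j))
        (le (nn x<1 ⊕ nn lt) (((∀ u v w → 0ℤ - (1ℤ + (u + (v - w))) ≡ 1ℤ - (1ℤ + u) + (w - (1ℤ + v))) ∋ solve-∀) x
        (c t i) (c t j))))))

-- Stretching a residue class

module _ (d : ℕ) (d>0 : 1 ℕ.≤ d) where
  private
    instance
      d≢0 : ℕ.NonZero d
      d≢0 = ℕ.>-nonZero d>0

  abstract
    -- The quotient z / d rounded up, by floor division of - z; `remainder z` is what has to be
    -- added to z to reach the multiple.
    ceiling : ℤ → ℤ
    ceiling z = - ((- z) ℤ./ℕ d)

    remainder : ℤ → ℤ
    remainder z = + ((- z) ℤ.%ℕ d)

    remainder< : ∀ z → 1ℤ + remainder z ≤ + d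
    remainder< z = ℤ.+≤+ (ℤ.n%ℕd<d (- z) d)

    ceiling-eq : ∀ z → z ≡ ceiling z * + d - remainder z
    ceiling-eq z = eq (ze (sym (ℤ.a≡a%ℕn+[a/ℕn]*n (- z) d))) (lemma z (remainder z) ((- z) ℤ./ℕ d) (+ d))
      where
      lemma : ∀ z r q d → - q * d - r - z ≡ - z - (r + q * d)
      lemma = solve-∀

    *d-mono : ∀ {i j} → i ≤ j → i * + d ≤ j * + d
    *d-mono = *-monoʳ-≤-nonNeg (+ d)

    -- Together with `≤-ceiling` this is the adjunction with multiplication by d, through which
    -- `ceiling` is used from here on.
    ceiling-≤ : ∀ {z k} → z ≤ k * + d → ceiling z ≤ k
    ceiling-≤ {z} {k} p with ≤-or-> (ceiling z) k
    ... | inj₁ q = q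
    ... | inj₂ q = absurd (nn p ⊕ from≡ (sym (ceiling-eq z)) ⊕ nn (*d-mono q) ⊕ nn (remainder< z))
        (lemma z k (ceiling z) (remainder z) (+ d))
      where
      lemma : ∀ z k q r d → k * d - z + (z - (q * d - r)) + (q * d - (1ℤ + k) * d) + (d - (1ℤ + r)) ≡ -1ℤ
      lemma = solve-∀

    ≤-ceiling : ∀ {z k} → ceiling z ≤ k → z ≤ k * + d
    ≤-ceiling {z} {k} p = le (nn (*d-mono p) ⊕ from≡ (ceiling-eq z) ⊕ 0≤+ {(- z) ℤ.%ℕ d})
        (lemma z k (ceiling z) (remainder z) (+ d))
      where
      lemma : ∀ z k q r d → k * d - z ≡ k * d - q * d + ((q * d - r) - z) + r
      lemma = solve-∀

  -- The height function of the bead set { w + [d ∣ w] n d : w < e }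
  stretched : ℕ → ℤ → ℤ → ℤ
  stretched n e z = ⁺ (e - z) + (⁺ (ceiling e - ceiling z + + n) - ⁺ (ceiling e - ceiling z))

  jump : ℕ → ∀ {z} → Dec (+ d ℤ.∣ z) → ℤ
  jump n (yes _) = + n * + d
  jump n (no _)  = 0ℤ

  private
    Δ-⁺ : ∀ {a b} → a ≡ 1ℤ + b → ⁺ a - ⁺ b ≡ θ b
    Δ-⁺ {b = b} refl = trans (cong (_- ⁺ b) (⁺-suc b)) (lemma (⁺ b) (θ b))
      where
      lemma : ∀ u v → u + v - u ≡ v
      lemma = solve-∀

    θ-⇔ : ∀ a b → (0ℤ ≤ a → 0ℤ ≤ b) → (0ℤ ≤ b → 0ℤ ≤ a) → θ a ≡ θ b
    θ-⇔ a b f g with ≤-or-> 0ℤ a | ≤-or-> 0ℤ b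
    ... | inj₁ p | _      = trans (θ-yes p) (sym (θ-yes (f p)))
    ... | inj₂ p | inj₁ q = absurd (nn p ⊕ g q) (((∀ u → 0ℤ - (1ℤ + u) + u ≡ -1ℤ) ∋ solve-∀) a)
    ... | inj₂ p | inj₂ q = trans (θ-no p) (sym (θ-no q))

    ceiling-multiple : ∀ k → ceiling (k * + d) ≡ k
    ceiling-multiple k = ≤-antisym (ceiling-≤ ≤-refl) (*-cancelʳ-≤-pos k (ceiling (k * + d)) (+ d)
        {{ℤ.positive (ℤ.+<+ d>0)}} (≤-ceiling ≤-refl))

    ceiling-mono : ∀ {x y} → x ≤ y → ceiling x ≤ ceiling y
    ceiling-mono p = ceiling-≤ (≤-trans p (≤-ceiling ≤-refl))

    ceiling-suc-multiple : ∀ k → ceiling (1ℤ + k * + d) ≡ 1ℤ + k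
    ceiling-suc-multiple k = ≤-antisym
      (ceiling-≤ (le (nn (ℤ.+≤+ d>0)) (lemma k (+ d))))
      ([ (λ p → absurd (nn (≤-ceiling p)) (((∀ u v → u * v - (1ℤ + u * v) ≡ -1ℤ) ∋ solve-∀) k (+ d))) , (λ p → p) ]′
          (≤-or-> (ceiling (1ℤ + k * + d)) k))
      where
      lemma : ∀ k d → (1ℤ + k) * d - (1ℤ + k * d) ≡ d - 1ℤ
      lemma = solve-∀

    ceiling-suc : ∀ {z} → ¬ + d ℤ.∣ z → ceiling (1ℤ + z) ≡ ceiling z
    ceiling-suc {z} ¬d = ≤-antisym
      (ceiling-≤ ([ (λ e → ⊥-elim (¬d (divides (ceiling z) e))) , (λ p → p) ]′ (≤-split (≤-ceiling {z} ≤-refl))))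
      (ceiling-mono (i≤suc[i] z))

    -- Both sides test whether the multiple k d lies below e.
    threshold-ceiling : ∀ e k → θ (ceiling e - k - 1ℤ) ≡ θ (e - k * + d - 1ℤ)
    threshold-ceiling e k = θ-⇔ _ _
      (λ p → [ (λ q → absurd (p ⊕ nn (ceiling-≤ {e} {k} q)) (((∀ u v → u + - v + - 1ℤ + (v - u) ≡ -1ℤ) ∋ solve-∀)
          (ceiling e) k)) , (λ q → le (nn q) (((∀ u v w → u + - (v * w) + - 1ℤ - 0ℤ ≡ u - (1ℤ + v * w)) ∋ solve-∀) e k
          (+ d))) ]′ (≤-or-> e (k * + d)))
      (λ p → [ (λ q → absurd (p ⊕ nn (≤-ceiling {e} {k} q))
          (((∀ u v w → u + - (v * w) + - 1ℤ + (v * w - u) ≡ -1ℤ) ∋ solve-∀) e k (+ d))) ,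
          (λ q → le (nn q) (((∀ u v → u + - v + - 1ℤ - 0ℤ ≡ u - (1ℤ + v)) ∋ solve-∀) (ceiling e) k)) ]′
          (≤-or-> (ceiling e) k))

  -- The positive part of `ceiling e - ceiling z` counts the multiples of d in [z, e). At a
  -- non-multiple z only the first summand of `stretched` changes. At a multiple the last summand
  -- cancels the bead left behind, and the one with n brings in the bead from n d places below.
  Δ-stretched : ∀ n e z (D : Dec (+ d ℤ.∣ z)) → Δ (stretched n e) z ≡ θ (e - z - 1ℤ + jump n D)
  Δ-stretched n e z (no ¬d) = trans
    (cong (λ q → stretched n e z - (⁺ (e - (1ℤ + z)) + (⁺ (ceiling e - q + + n) - ⁺ (ceiling e - q)))) (ceiling-suc ¬d))
    (trans (lemma (⁺ (e - z)) (⁺ (e - (1ℤ + z))) (⁺ (ceiling e - ceiling z + + n) - ⁺ (ceiling e - ceiling z)))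
    (trans (Δ-⁺ {e - z} {e - (1ℤ + z)} (((∀ u v → u - v ≡ 1ℤ + (u - (1ℤ + v))) ∋ solve-∀) e z))
        (cong θ {e - (1ℤ + z)} {e - z - 1ℤ + 0ℤ} (((∀ u v → u - (1ℤ + v) ≡ u - v - 1ℤ + 0ℤ) ∋ solve-∀) e z))))
    where
    lemma : ∀ a b u → a + u - (b + u) ≡ a - b
    lemma = solve-∀
  Δ-stretched n e .(k * + d) (yes (divides k refl)) = trans
    (cong₂ (λ q q′ → ⁺ (e - z) + (⁺ (ceiling e - q + + n) - ⁺ (ceiling e - q))
        - (⁺ (e - (1ℤ + z)) + (⁺ (ceiling e - q′ + + n) - ⁺ (ceiling e - q′))))
      (ceiling-multiple k) (ceiling-suc-multiple k))
    (trans (lemma (⁺ (e - z)) (⁺ (e - (1ℤ + z))) (⁺ (ceiling e - k + + n)) (⁺ (ceiling e - k))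
        (⁺ (ceiling e - (1ℤ + k) + + n)) (⁺ (ceiling e - (1ℤ + k))))
    (trans (cong₂ (λ u v → u + (v - (⁺ (ceiling e - k) - ⁺ (ceiling e - (1ℤ + k)))))
      {⁺ (e - z) - ⁺ (e - (1ℤ + z))} {θ (ceiling e - k - 1ℤ)} {⁺ (ceiling e - k + + n) - ⁺ (ceiling e - (1ℤ + k) + + n)}
          {θ (e - (k - + n) * + d - 1ℤ)}
      (trans (Δ-⁺ {e - z} {e - (1ℤ + z)} (((∀ u v → u - v ≡ 1ℤ + (u - (1ℤ + v))) ∋ solve-∀) e z))
          (trans (cong θ {e - (1ℤ + z)} {e - z - 1ℤ} (((∀ u v → u - (1ℤ + v) ≡ u - v - 1ℤ) ∋ solve-∀) e z))
          (sym (threshold-ceiling e k))))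
      (trans (Δ-⁺ {ceiling e - k + + n} {ceiling e - (1ℤ + k) + + n}
          (((∀ u v w → u - v + w ≡ 1ℤ + (u - (1ℤ + v) + w)) ∋ solve-∀) (ceiling e) k (+ n)))
          (trans (cong θ {ceiling e - (1ℤ + k) + + n} {ceiling e - (k - + n) - 1ℤ}
          (((∀ u v w → u - (1ℤ + v) + w ≡ u - (v - w) - 1ℤ) ∋ solve-∀) (ceiling e) k (+ n)))
          (threshold-ceiling e (k - + n)))))
    (trans (cong (λ u → θ (ceiling e - k - 1ℤ) + (θ (e - (k - + n) * + d - 1ℤ) - u))
        (trans (Δ-⁺ {ceiling e - k} {ceiling e - (1ℤ + k)} (((∀ u v → u - v ≡ 1ℤ + (u - (1ℤ + v))) ∋ solve-∀)
        (ceiling e) k)) (cong θ {ceiling e - (1ℤ + k)} {ceiling e - k - 1ℤ}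
        (((∀ u v → u - (1ℤ + v) ≡ u - v - 1ℤ) ∋ solve-∀) (ceiling e) k))))
    (trans (cancel (θ (ceiling e - k - 1ℤ)) (θ (e - (k - + n) * + d - 1ℤ))) (cong θ (regroup e k (+ n) (+ d)))))))
    where
    z = k * + d
    lemma : ∀ a b u v u′ v′ → a + (u - v) - (b + (u′ - v′)) ≡ (a - b) + ((u - u′) - (v - v′))
    lemma = solve-∀
    cancel : ∀ u v → u + (v - u) ≡ v
    cancel = solve-∀
    regroup : ∀ e k n d → e - (k - n) * d - 1ℤ ≡ e - k * d - 1ℤ + n * d
    regroup = solve-∀

  stretched-height : ∀ n e → Height (e + + n) (stretched n e)
  stretched-height n e = record
    { bit = λ z → subst Bit (sym (Δ-stretched n e z (+ d ∣? z))) (θ-bit _)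
    ; right = right∩ (λ {z} p q → cong₂ _+_ (⁺-nonpos {e - z}
        (le (nn p) (((∀ u v → 0ℤ - (u - v) ≡ v - u) ∋ solve-∀) e z)))
        (cong₂ _-_ (⁺-nonpos {ceiling e - ceiling z + + n} (le (nn q)
        (((∀ u v w → 0ℤ - (u - v + w) ≡ v - (u + w)) ∋ solve-∀) (ceiling e) (ceiling z) (+ n))))
        (⁺-nonpos {ceiling e - ceiling z} (le (nn q ⊕ 0≤+ {n})
        (((∀ u v w → 0ℤ - (u - v) ≡ v - (u + w) + w) ∋ solve-∀) (ceiling e) (ceiling z) (+ n))))))
        (e , λ z p → p) ((ceiling e + + n) * + d , λ z p → ≤-trans
            (≤-reflexive (sym (ceiling-multiple (ceiling e + + n)))) (ceiling-mono p))
    ; left = e , λ z p → let q = ceiling-mono p in trans (cong₂ _+_ (⁺-nonneg {e - z} (nn p)) (cong₂ _-_ (⁺-nonneg {ceiling e - ceiling z + + n} (le (nn q ⊕ 0≤+ {n}) (((∀ u v w → u - v + w - 0ℤ ≡ u - v + w) ∋ solve-∀) (ceiling e) (ceiling z) (+ n)))) (⁺-nonneg {ceiling e - ceiling z} (nn q)))) (((∀ u v w x y → u - v + (w - x + y - (w - x)) ≡ u + y - v) ∋ solve-∀) e z (ceiling e) (ceiling z) (+ n))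
    }

jump≤ : ∀ d d>0 n {z} (D : Dec (+ d ℤ.∣ z)) → jump d d>0 n D ≤ + n * + d
jump≤ d d>0 n (yes _) = ≤-refl
jump≤ d d>0 n (no _)  = ≤-trans 0≤+ (≤-reflexive (pos-* n d))

jump-cong : ∀ d d>0 n {z z′} (D : Dec (+ d ℤ.∣ z)) (D′ : Dec (+ d ℤ.∣ z′)) → (+ d ℤ.∣ z → + d ℤ.∣ z′) →
  (+ d ℤ.∣ z′ → + d ℤ.∣ z) →
  jump d d>0 n D ≡ jump d d>0 n D′
jump-cong d d>0 n (yes p) (yes q) f g = refl
jump-cong d d>0 n (yes p) (no ¬q) f g = ⊥-elim (¬q (f p))
jump-cong d d>0 n (no ¬p) (yes q) f g = ⊥-elim (¬p (g q))
jump-cong d d>0 n (no ¬p) (no ¬q) f g = refl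

module _ {T : Set} (c : T → Fin (suc l) → ℤ) (b : ℕ) (e : Fin (suc l) → ℤ) (e₀ : e zero ≡ 1ℤ)
  (congruent : ∀ t i j → + suc (suc b) ℤ.∣ (c t i - c t j) - (e i - e j)) where

  private
    d : ℕ
    d = suc (suc b)
    d>0 : 1 ℕ.≤ d
    d>0 = ℕ.s≤s ℕ.z≤n

    -- The translation by e i + n, the charge of the stretched diagram, brings it back to charge 0.
    g : ℕ → Fin (suc l) → ℤ → ℤ
    g n i x = stretched d d>0 n (e i) (x + (e i + + n))

    g-height : ∀ n i → Height 0ℤ (g n i)
    g-height n i = height-cong (+-inverseʳ (e i + + n)) (λ _ → refl)
        (shift (e i + + n) (stretched-height d d>0 n (e i)))

    Δ-g : ∀ n i x (D : Dec (+ d ℤ.∣ (x + (e i + + n)))) → Δ (g n i) x ≡ θ (jump d d>0 n D - x - + n - 1ℤ)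
    Δ-g n i x D = trans (Δ-shift (stretched d d>0 n (e i)) (e i + + n) x)
        (trans (Δ-stretched d d>0 n (e i) (x + (e i + + n)) D)
      (cong θ (lemma (e i) x (+ n) (jump d d>0 n D))))
      where
      lemma : ∀ e x n j → e - (x + (e + n)) - 1ℤ + j ≡ j - x - n - 1ℤ
      lemma = solve-∀

    -- By `congruent` the two places compared lie in the same class modulo d, so the jumps agree,
    -- and what remains is c t i ≤ c t j.
    edges : ∀ n t i j → c t i ≤ c t j → ∀ x → Δ (g n i) x ≤ Δ (g n j) (x + (c t i - c t j))
    edges n t i j le₁ x = ≤-trans (≤-reflexive (Δ-g n i x D))
        (≤-trans (θ-mono bound) (≤-reflexive (sym (Δ-g n j x′ D′))))
      where
      x′ = x + (c t i - c t j)
      D = + d ∣? (x + (e i + + n))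
      D′ = + d ∣? (x′ + (e j + + n))
      z′≡ : (x + (c t i - c t j)) + (e j + + n) ≡ (x + (e i + + n)) + ((c t i - c t j) - (e i - e j))
      z′≡ = (((∀ u v w x y z → u + (v - w) + (x + y) ≡ u + (z + y) + (v - w - (z - x))) ∋ solve-∀) x (c t i) (c t j)
          (e j) (+ n) (e i))
      jumps : jump d d>0 n D ≡ jump d d>0 n D′
      jumps = jump-cong d d>0 n D D′
        (λ p → subst (+ d ℤ.∣_) (sym z′≡) (∣m∣n⇒∣m+n p (congruent t i j)))
        (λ p → ∣m+n∣n⇒∣m {m = x + (e i + + n)} (subst (+ d ℤ.∣_) z′≡ p) (congruent t i j))
      bound : jump d d>0 n D - x - + n - 1ℤ ≤ jump d d>0 n D′ - x′ - + n - 1ℤ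
      bound = le (nn le₁ ⊕ from≡ jumps) (lemma (jump d d>0 n D) (jump d d>0 n D′) x (+ n) (c t i) (c t j))
        where
        lemma : ∀ u v x n a b → v - (x + (a - b)) - n - 1ℤ - (u - x - n - 1ℤ) ≡ b - a + (v - u)
        lemma = solve-∀

    distinct : ∀ {m n} → m ℕ.< n → ∃ λ x → Δ (g m zero) x ≢ Δ (g n zero) x
    distinct {m} {n} m<n = x , λ same → case (trans (sym gap) (trans same filled))
      where
      -- As e zero is 1, the bead at 0 jumps to n d; this is its place in charge 0. It increases
      -- with n because d is at least 2, so for m < n it lies above all beads.
      x = + n * + d - 1ℤ - + n
      D = + d ∣? (x + (e zero + + m))
      filled : Δ (g n zero) x ≡ 1ℤ
      filled = trans (Δ-g n zero x (yes (divides (+ n) (trans (cong (λ u → x + (u + + n)) e₀) (lemma (+ n) (+ d))))))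
        (cong θ {y = 0ℤ} (lemma′ (+ n) (+ d)))
        where
        lemma : ∀ n d → n * d - 1ℤ - n + (1ℤ + n) ≡ n * d
        lemma = solve-∀
        lemma′ : ∀ n d → n * d - (n * d - 1ℤ - n) - n - 1ℤ ≡ 0ℤ
        lemma′ = solve-∀
      gap : Δ (g m zero) x ≡ 0ℤ
      gap with ≤⇒+ (ℤ.+≤+ m<n)
      ... | a , n≡ = trans (Δ-g m zero x D)
          (θ-no (le (nn (jump≤ d d>0 m D) ⊕ 0≤+ {a ℕ.+ b ℕ.+ a ℕ.* b})
          (trans (cong (λ n → 0ℤ - (1ℤ + (jump d d>0 m D - (n * + d - 1ℤ - n) - + m - 1ℤ))) n≡)
                   (trans (lemma (jump d d>0 m D) (+ m) (+ a) (+ b))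
                       (cong (λ u → + m * + d - jump d d>0 m D + (+ a + + b + u)) (sym (pos-* a b)))))))
        where
        lemma : ∀ j m a b → 0ℤ - (1ℤ + (j - ((1ℤ + m + a) * (+ 2 + b) - 1ℤ - (1ℤ + m + a)) - m - 1ℤ)) ≡ m * (+ 2 + b)
          - j + (a + b + a * b)
        lemma = solve-∀
      case : 0ℤ ≢ 1ℤ
      case ()

  congruent-infinite : ¬ FiniteSet (SimCore c)
  congruent-infinite = infinitely-many c g g-height edges zero distinct

-- From finiteness to the two conditions

module _ (em : ExcludedMiddle 0ℓ) {T : Set} (c : T → Fin (suc l) → ℤ) where

  divisor-infinite : ∀ b → (∀ x → gSet c x → suc (suc b) ℕ.∣ ∣ x ∣) → ¬ FiniteSet (SimCore c)
  divisor-infinite b common with em {T}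
  ... | no ¬t = congruent-infinite c b (λ _ → 1ℤ) refl λ t → ⊥-elim (¬t t)
  -- Any one u supplies e, normalised to e zero = 1; the required congruences are then divisibility
  -- of the elements of `gSet` for t and u.
  ... | yes u = congruent-infinite c b (λ i → c u i - c u zero + 1ℤ) (cong (_+ 1ℤ) (+-inverseʳ (c u zero))) λ t i j →
    subst (+ suc (suc b) ℤ.∣_) (lemma (c t i) (c t j) (c u i) (c u j) (c u zero))
      (∣ᵤ⇒∣ (common _ (inj₂ (t , u , i , j , refl))))
    where
    lemma : ∀ a b p q z → ((a - b) - p) + q ≡ (a - b) - ((p - z + 1ℤ) - (q - z + 1ℤ))
    lemma = solve-∀

  finite⇒gIsOne : FiniteSet (SimCore c) → gIsOne c
  finite⇒gIsOne fin with em {∃ λ d → (∀ x → gSet c x → d ℕ.∣ ∣ x ∣) × d ≢ 1}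
  -- A common divisor 0 means that all elements are 0, and then 2 is a common divisor as well.
  ... | yes (zero , common , _) = ⊥-elim (divisor-infinite 0
      (λ x s → subst (2 ℕ.∣_) (sym (ℕ.0∣⇒≡0 (common x s))) (2 ℕ.∣0)) fin)
  ... | yes (suc zero , _ , d≢1) = ⊥-elim (d≢1 refl)
  ... | yes (suc (suc b) , common , _) = ⊥-elim (divisor-infinite b common fin)
  ... | no none = (λ x _ → ℕ.1∣ ∣ x ∣) , λ d common → subst (ℕ._∣ 1)
      (sym (decidable-stable (d ℕ.≟ 1) λ d≢1 → none (d , common , d≢1))) ℕ.∣-refl

  -- For empty T the set `gSet` is empty, so 0 is vacuously a common divisor and would have to
  -- divide 1.
  gIsOne⇒inhabited : gIsOne c → T
  gIsOne⇒inhabited (_ , greatest) = decidable-stable em λ empty →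
    case ℕ.0∣⇒≡0 (greatest 0 λ { x (inj₁ (t , _)) → ⊥-elim (empty t) ; x (inj₂ (t , _)) → ⊥-elim (empty t) }) of λ ()

  finite⇒conditionX : T → FiniteSet (SimCore c) → ConditionX c
  finite⇒conditionX t₀ fin =
    decidable-stable em (λ none → rows-infinite em c t₀ (λ k s → decidable-stable em λ ¬always → none (k , s , ¬always))
        fin) ,
    decidable-stable em (λ none → columns-infinite em c t₀ (λ k s → decidable-stable em λ ¬always → none
        (k , s , ¬always)) fin)

theorem3p4 : ExcludedMiddle 0ℓ → (l : ℕ) → 0 < l → (T : Set) → (c : T → Fin l → ℤ) →
    FiniteSet (SimCore c) ⇔ (gIsOne c × ConditionX c)
theorem3p4 em (suc l) _ T c = mk⇔
  (λ fin → let g = finite⇒gIsOne em c fin in g , finite⇒conditionX em c (gIsOne⇒inhabited em c g) fin)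
  (λ (g , x) → finite em c g x)
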